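{- Let $T$ be a tree of order $n\ge 3$ and let $v$ be a vertex of $T$. If $T$ is not NEB at $v$, then no $A\in S^-(T)$ has the Duarte property with respect to the vertex $v$.
   Context: For a real skew-symmetric matrix $A=[a_{i,j}]$ of order $n$, its graph $G(A)$ has vertex set $\{1,\ldots,n\}$ and edge set $\{\{i,j\}: a_{i,j}\ne 0,\ i<j\}$. $S^-(T)$ is the set of all real skew-symmetric matrices whose graph is $T$. For a vertex $w$ of a tree $T$, $T(w)$ is the forest obtained by deleting $w$; for a neighbor $v$ of $w$, $T_v(w)$ is the connected component of $T(w)$ containing $v$. For $A\in S^-(T)$, $A(w)$ and $A_v(w)$ denote the principal submatrices of $A$ corresponding to $T(w)$ and $T_v(w)$ (rows and columns keep their vertex labels). Order on $\mathrm{i}\mathbb{R}$: $a\le b$ means $-\mathrm{i}a\le-\mathrm{i}b$ as real numbers. Spectra of real skew-symmetric matrices (contained in $\mathrm{i}\mathbb{R}$) are listed with multiplicity in increasing order; $\{\mu_1,\ldots,\mu_{n-1}\}$ strictly interlaces $\{\lambda_1,\ldots,\lambda_n\}$ if $\lambda_1<\mu_1<\lambda_2<\cdots<\mu_{n-1}<\lambda_n$. Duarte property (recursive): let $A$ be a matrix whose graph is a tree and $w$ a vertex of $G(A)$. If $G(A)$ has just one vertex, $A$ has the Duarte property with respect to $w$. If $G(A)$ has more than one vertex, $A$ has the Duarte property with respect to $w$ provided the eigenvalues of $A(w)$ strictly interlace those of $A$ and, for each neighbor $v$ of $w$, $A_v(w)$ has the Duarte property with respect to $v$. NEB (nearly even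 branching; recursive): let $T$ be a tree on $n$ vertices and $w$ a vertex of $T$. If $n=1$, $T$ is NEB at $w$. If $n\ge2$, $T$ is NEB at $w$ if (i) $T(w)$ has exactly one odd component (a connected component with an odd number of vertices) when $n$ is even, and no odd component when $n$ is odd; and (ii) for each neighbor $v$ of $w$ in $T$, $T_v(w)$ is NEB at $v$. -}

module Defs where

open import Algebra.Bundles.Raw using (RawRing)
import Algebra.Definitions.RawMonoid as RawSum
import Algebra.Definitions.RawSemiring as RawPower
open import Data.Bool.Base using (if_then_else_)
open import Data.Fin.Base as Fin using (Fin; zero; suc; toℕ)
import Data.Fin.Properties as Fin
open import Data.Fin.Subset using (Subset; inside; outside; ∣_∣; ⊤; _-_; _∈_; _⊆_; Nonempty)
open import Data.List.Base using (_∷_; _∷ʳ_)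
open import Data.List.Relation.Unary.Linked using (Linked)
open import Data.List.Relation.Unary.Unique.Propositional using (Unique)
open import Data.Nat.Base as ℕ using (ℕ; zero; suc)
open import Data.Nat.Divisibility using (_∣_; _∤_)
import Data.Nat.Properties as ℕ
open import Data.Product using (∃; ∃!; ∃-syntax; _×_; _,_)
open import Data.Rational.Base as ℚ using (ℚ; 0ℚ; 1ℚ; ½)
import Data.Rational.Properties as ℚ
open import Data.Rational.Solver using (module +-*-Solver)
open import Data.Sum.Base as Sum using (_⊎_; inj₁; inj₂)
open import Data.Vec.Base as Vec using (Vec; []; _∷_)
open import Data.Vec.Functional using (removeAt)
open import Function.Bundles using (_⇔_)
open import Level using (0ℓ)
open import Relation.Binary.Core using (Rel)
open import Relation.Binary.Construct.Closure.ReflexiveTransitive using (Star)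
open import Relation.Binary.PropositionalEquality
  using (_≡_; refl; sym; trans; cong; subst)
open import Relation.Nullary using (¬_; does)

-- Real numbers are Cauchy sequences of rationals; the equality _≃_ identifies
-- sequences whose difference tends to 0.
IsCauchy : (ℕ → ℚ) → Set
IsCauchy x = ∀ ε → 0ℚ ℚ.< ε →
  ∃[ N ] (∀ m n → N ℕ.≤ m → N ℕ.≤ n → ℚ.∣ x m ℚ.- x n ∣ ℚ.< ε)

record ℝ : Set where
  constructor mkℝ
  field
    seq    : ℕ → ℚ
    cauchy : IsCauchy seq

open ℝ public

infix 4 _≃_ _<ℝ_

_≃_ : ℝ → ℝ → Set
x ≃ y = ∀ ε → 0ℚ ℚ.< ε →
  ∃[ N ] (∀ n → N ℕ.≤ n → ℚ.∣ seq x n ℚ.- seq y n ∣ ℚ.< ε)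

_<ℝ_ : ℝ → ℝ → Set
x <ℝ y = ∃[ ε ] 0ℚ ℚ.< ε ×
  (∃[ N ] (∀ n → N ℕ.≤ n → seq x n ℚ.+ ε ℚ.< seq y n))

half-pos : ∀ {ε} → 0ℚ ℚ.< ε → 0ℚ ℚ.< ½ ℚ.* ε
half-pos {ε} 0<ε = subst (ℚ._< ½ ℚ.* ε) (ℚ.*-zeroʳ ½) (ℚ.*-monoʳ-<-pos ½ 0<ε)

half+half : ∀ ε → ½ ℚ.* ε ℚ.+ ½ ℚ.* ε ≡ ε
half+half ε = trans (sym (ℚ.*-distribʳ-+ ε ½ ½)) (ℚ.*-identityˡ ε)

sum-close : ∀ {ε} p q → ℚ.∣ p ∣ ℚ.< ½ ℚ.* ε → ℚ.∣ q ∣ ℚ.< ½ ℚ.* ε →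
            ℚ.∣ p ℚ.+ q ∣ ℚ.< ε
sum-close {ε} p q p< q< = ℚ.≤-<-trans (ℚ.∣p+q∣≤∣p∣+∣q∣ p q)
  (subst (ℚ.∣ p ∣ ℚ.+ ℚ.∣ q ∣ ℚ.<_) (half+half ε) (ℚ.+-mono-< p< q<))

bounded : ∀ x → IsCauchy x →
  ∃[ B ] ℚ.Positive B × ∃[ N ] (∀ n → N ℕ.≤ n → ℚ.∣ x n ∣ ℚ.≤ B)
bounded x c with c 1ℚ (ℚ.positive⁻¹ 1ℚ)
... | N , close = 1ℚ ℚ.+ ℚ.∣ x N ∣
                , ℚ.pos+nonNeg⇒pos 1ℚ ℚ.∣ x N ∣ {{ℚ.∣-∣-nonNeg (x N)}}
                , N , bound
  where
  split : ∀ p q → p ≡ (p ℚ.- q) ℚ.+ q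
  split = solve 2 (λ p q → p := (p :- q) :+ q) refl
    where open +-*-Solver
  bound : ∀ n → N ℕ.≤ n → ℚ.∣ x n ∣ ℚ.≤ 1ℚ ℚ.+ ℚ.∣ x N ∣
  bound n N≤n = ℚ.≤-trans
    (ℚ.≤-trans (ℚ.≤-reflexive (cong ℚ.∣_∣ (split (x n) (x N))))
               (ℚ.∣p+q∣≤∣p∣+∣q∣ (x n ℚ.- x N) (x N)))
    (ℚ.+-monoˡ-≤ ℚ.∣ x N ∣ (ℚ.<⇒≤ (close n N N≤n ℕ.≤-refl)))

module _ (B : ℚ) (B>0 : ℚ.Positive B) where
  private instance
    _ = B>0
    _ = ℚ.pos⇒nonZero B
    _ = ℚ.pos⇒nonNeg B

  scaled : ℚ → ℚ
  scaled ε = ℚ.1/ B ℚ.* ε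

  scaled-pos : ∀ {ε} → 0ℚ ℚ.< ε → 0ℚ ℚ.< scaled ε
  scaled-pos {ε} 0<ε = subst (ℚ._< scaled ε) (ℚ.*-zeroʳ (ℚ.1/ B))
    (ℚ.*-monoʳ-<-pos (ℚ.1/ B) {{ℚ.1/pos⇒pos B}} 0<ε)

  product-small : ∀ {ε} p q → ℚ.∣ p ∣ ℚ.≤ B → ℚ.∣ q ∣ ℚ.< scaled ε →
                  ℚ.∣ p ℚ.* q ∣ ℚ.< ε
  product-small {ε} p q p≤ q< = ℚ.≤-<-trans
    (ℚ.≤-trans (ℚ.≤-reflexive (ℚ.∣p*q∣≡∣p∣*∣q∣ p q))
               (ℚ.*-monoʳ-≤-nonNeg ℚ.∣ q ∣ {{ℚ.∣-∣-nonNeg q}} p≤))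
    (subst (B ℚ.* ℚ.∣ q ∣ ℚ.<_) cancel (ℚ.*-monoʳ-<-pos B q<))
    where
    cancel : B ℚ.* (ℚ.1/ B ℚ.* ε) ≡ ε
    cancel = trans (sym (ℚ.*-assoc B (ℚ.1/ B) ε))
      (trans (cong (ℚ._* ε) (ℚ.*-inverseʳ B)) (ℚ.*-identityˡ ε))

constant : ℚ → ℝ
constant q = mkℝ (λ _ → q) λ ε 0<ε → 0 , λ _ _ _ _ →
  subst (λ d → ℚ.∣ d ∣ ℚ.< ε) (sym (ℚ.+-inverseʳ q)) 0<ε

0ℝ 1ℝ : ℝ
0ℝ = constant 0ℚ
1ℝ = constant 1ℚ

infix  8 -ℝ_
infixl 7 _*ℝ_
infixl 6 _+ℝ_ _-ℝ_

_+ℝ_ : ℝ → ℝ → ℝ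
seq    (x +ℝ y) n = seq x n ℚ.+ seq y n
cauchy (x +ℝ y) ε 0<ε
  with cauchy x (½ ℚ.* ε) (half-pos 0<ε) | cauchy y (½ ℚ.* ε) (half-pos 0<ε)
... | M , closeX | N , closeY = M ℕ.⊔ N , λ m n m≥ n≥ →
  subst (λ d → ℚ.∣ d ∣ ℚ.< ε) (regroup (seq x m) (seq x n) (seq y m) (seq y n))
    (sum-close (seq x m ℚ.- seq x n) (seq y m ℚ.- seq y n)
      (closeX m n (ℕ.m⊔n≤o⇒m≤o M N m≥) (ℕ.m⊔n≤o⇒m≤o M N n≥))
      (closeY m n (ℕ.m⊔n≤o⇒n≤o M N m≥) (ℕ.m⊔n≤o⇒n≤o M N n≥)))
  where
  regroup : ∀ a b c d → (a ℚ.- b) ℚ.+ (c ℚ.- d) ≡ (a ℚ.+ c) ℚ.- (b ℚ.+ d)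
  regroup = solve 4 (λ a b c d → (a :- b) :+ (c :- d) := (a :+ c) :- (b :+ d)) refl
    where open +-*-Solver

-ℝ_ : ℝ → ℝ
seq    (-ℝ x) n = ℚ.- seq x n
cauchy (-ℝ x) ε 0<ε with cauchy x ε 0<ε
... | N , close = N , λ m n m≥ n≥ →
  subst (λ d → ℚ.∣ d ∣ ℚ.< ε) (flip (seq x m) (seq x n)) (close n m n≥ m≥)
  where
  flip : ∀ a b → b ℚ.- a ≡ (ℚ.- a) ℚ.- (ℚ.- b)
  flip = solve 2 (λ a b → b :- a := (:- a) :- (:- b)) refl
    where open +-*-Solver

_-ℝ_ : ℝ → ℝ → ℝ
x -ℝ y = x +ℝ (-ℝ y)

product-close : ∀ {B C ε a b c d} (B>0 : ℚ.Positive B) (C>0 : ℚ.Positive C) →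
  ℚ.∣ a ∣ ℚ.≤ B → ℚ.∣ c ℚ.- d ∣ ℚ.< scaled B B>0 (½ ℚ.* ε) →
  ℚ.∣ d ∣ ℚ.≤ C → ℚ.∣ a ℚ.- b ∣ ℚ.< scaled C C>0 (½ ℚ.* ε) →
  ℚ.∣ a ℚ.* c ℚ.- b ℚ.* d ∣ ℚ.< ε
product-close {B} {C} {ε} {a} {b} {c} {d} B>0 C>0 a≤ cd< d≤ ab< =
  subst (λ e → ℚ.∣ e ∣ ℚ.< ε) (regroup a b c d)
    (sum-close (a ℚ.* (c ℚ.- d)) (d ℚ.* (a ℚ.- b))
      (product-small B B>0 a (c ℚ.- d) a≤ cd<)
      (product-small C C>0 d (a ℚ.- b) d≤ ab<))
  where
  regroup : ∀ a b c d →
    a ℚ.* (c ℚ.- d) ℚ.+ d ℚ.* (a ℚ.- b) ≡ a ℚ.* c ℚ.- b ℚ.* d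
  regroup = solve 4 (λ a b c d →
    a :* (c :- d) :+ d :* (a :- b) := a :* c :- b :* d) refl
    where open +-*-Solver

product-cauchy : ∀ x y → IsCauchy x → IsCauchy y → IsCauchy (λ n → x n ℚ.* y n)
product-cauchy x y cx cy ε 0<ε = fromBounds (bounded x cx) (bounded y cy)
  where
  Bound : (ℕ → ℚ) → Set
  Bound z = ∃[ B ] ℚ.Positive B × ∃[ N ] (∀ n → N ℕ.≤ n → ℚ.∣ z n ∣ ℚ.≤ B)

  Close : (ℕ → ℚ) → ℚ → Set
  Close z δ = ∃[ N ] (∀ m n → N ℕ.≤ m → N ℕ.≤ n → ℚ.∣ z m ℚ.- z n ∣ ℚ.< δ)

  fromModuli : ∀ ((B , B>0 , _) : Bound x) ((C , C>0 , _) : Bound y) →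
    Close x (scaled C C>0 (½ ℚ.* ε)) → Close y (scaled B B>0 (½ ℚ.* ε)) →
    Close (λ n → x n ℚ.* y n) ε
  fromModuli (B , B>0 , K , boundX) (C , C>0 , L , boundY) (M , closeX) (N , closeY) =
    KL ℕ.⊔ MN , λ m n m≥ n≥ →
    let m≥KL = ℕ.m⊔n≤o⇒m≤o KL MN m≥; m≥MN = ℕ.m⊔n≤o⇒n≤o KL MN m≥
        n≥KL = ℕ.m⊔n≤o⇒m≤o KL MN n≥; n≥MN = ℕ.m⊔n≤o⇒n≤o KL MN n≥
    in product-close {B} {C} {ε} {x m} {x n} {y m} {y n} B>0 C>0
         (boundX m (ℕ.m⊔n≤o⇒m≤o K L m≥KL))
         (closeY m n (ℕ.m⊔n≤o⇒n≤o M N m≥MN) (ℕ.m⊔n≤o⇒n≤o M N n≥MN))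
         (boundY n (ℕ.m⊔n≤o⇒n≤o K L n≥KL))
         (closeX m n (ℕ.m⊔n≤o⇒m≤o M N m≥MN) (ℕ.m⊔n≤o⇒m≤o M N n≥MN))
    where
    KL = K ℕ.⊔ L
    MN = M ℕ.⊔ N

  fromBounds : Bound x → Bound y → Close (λ n → x n ℚ.* y n) ε
  fromBounds bx@(B , B>0 , _) by@(C , C>0 , _) = fromModuli bx by
    (cx (scaled C C>0 (½ ℚ.* ε)) (scaled-pos C C>0 {½ ℚ.* ε} (half-pos {ε} 0<ε)))
    (cy (scaled B B>0 (½ ℚ.* ε)) (scaled-pos B B>0 {½ ℚ.* ε} (half-pos {ε} 0<ε)))

_*ℝ_ : ℝ → ℝ → ℝ
seq    (x *ℝ y) n = seq x n ℚ.* seq y n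
cauchy (x *ℝ y)   = product-cauchy (seq x) (seq y) (cauchy x) (cauchy y)

record ℂ : Set where
  constructor _+i_
  field
    re im : ℝ

open ℂ public

ℂ-rawRing : RawRing 0ℓ 0ℓ
ℂ-rawRing = record
  { Carrier = ℂ
  ; _≈_ = λ z w → re z ≃ re w × im z ≃ im w
  ; _+_ = λ z w → (re z +ℝ re w) +i (im z +ℝ im w)
  ; _*_ = λ z w → (re z *ℝ re w -ℝ im z *ℝ im w) +i (re z *ℝ im w +ℝ im z *ℝ re w)
  ; -_  = λ z → (-ℝ re z) +i (-ℝ im z)
  ; 0#  = 0ℝ +i 0ℝ
  ; 1#  = 1ℝ +i 0ℝ
  }

fromℝ : ℝ → ℂ
fromℝ x = x +i 0ℝ

record iℝ : Set where
  constructor i·_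
  field
    coefficient : ℝ

open iℝ public

fromiℝ : iℝ → ℂ
fromiℝ (i· t) = 0ℝ +i t

infix 4 _<ⁱ_

-- The coefficient of a is - i a, so this is the order a < b iff - i a < - i b.
_<ⁱ_ : iℝ → iℝ → Set
a <ⁱ b = coefficient a <ℝ coefficient b

Matrix : Set → ℕ → Set
Matrix A n = Fin n → Fin n → A

module _ (R : RawRing 0ℓ 0ℓ) where
  open RawRing R
  open RawSum +-rawMonoid using (sum)
  open RawPower rawSemiring using (_^_)

  -- Laplace expansion along the first row.
  det : ∀ {n} → Matrix Carrier n → Carrier
  det {zero}  M = 1#
  det {suc n} M = sum λ j →
    ((- 1#) ^ toℕ j * M zero j) * det (λ i → removeAt (M (suc i)) j)

module _ where
  open RawRing ℂ-rawRing

  -- The characteristic polynomial of A, as the polynomial function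
  -- z ↦ det (z I - A) on ℂ; as ℂ is infinite, this determines the polynomial.
  charPoly : ∀ {n} → Matrix ℝ n → ℂ → ℂ
  charPoly A z = det ℂ-rawRing λ i j →
    z * (if does (i Fin.≟ j) then 1# else 0#) + - fromℝ (A i j)

  -- The entries of ts are the eigenvalues of A, listed with multiplicity: the
  -- characteristic polynomial is the product of the factors z - t. No ordering
  -- of the list is imposed here; strict interlacing forces it to be increasing.
  HasSpectrum : ∀ {n} → Matrix ℝ n → Vec iℝ n → Set
  HasSpectrum A ts = ∀ z →
    charPoly A z ≈ Vec.foldr′ (λ t p → (z + - fromiℝ t) * p) 1# ts

-- μs StrictlyInterlaces λs: λ₁ < μ₁ < λ₂ < … < μₖ < λₖ₊₁.
data _StrictlyInterlaces_ : ∀ {k m} → Vec iℝ k → Vec iℝ m → Set where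
  base : ∀ {a} → [] StrictlyInterlaces (a ∷ [])
  step : ∀ {k m a b c} {bs : Vec iℝ k} {cs : Vec iℝ m} →
         a <ⁱ b → b <ⁱ c → bs StrictlyInterlaces (c ∷ cs) →
         (b ∷ bs) StrictlyInterlaces (a ∷ c ∷ cs)

elements : ∀ {n} (S : Subset n) → Vec (Fin n) ∣ S ∣
elements []            = []
elements (outside ∷ S) = Vec.map suc (elements S)
elements (inside  ∷ S) = zero ∷ Vec.map suc (elements S)

principalSubmatrix : ∀ {n} → Matrix ℝ n → (S : Subset n) → Matrix ℝ ∣ S ∣
principalSubmatrix A S i j = A (Vec.lookup (elements S) i) (Vec.lookup (elements S) j)

record Graph (n : ℕ) : Set₁ where
  field
    Adj        : Rel (Fin n) 0ℓ
    symmetric  : ∀ {i j} → Adj i j → Adj j i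
    loopless   : ∀ {i} → ¬ Adj i i

open Graph public

InducedAdj : ∀ {n} → Graph n → Subset n → Rel (Fin n) 0ℓ
InducedAdj G S i j = i ∈ S × j ∈ S × Adj G i j

-- C is the vertex set of a connected component of the subgraph induced on S.
IsComponent : ∀ {n} → Graph n → Subset n → Subset n → Set
IsComponent G S C = Nonempty C × C ⊆ S ×
  (∀ x y → x ∈ C → y ∈ C ⇔ Star (InducedAdj G S) x y)

Connected : ∀ {n} → Graph n → Set
Connected {n} G = Fin n × (∀ i j → Star (Adj G) i j)

-- No cycle u, w, …, z, u on at least three distinct vertices.
Acyclic : ∀ {n} → Graph n → Set
Acyclic G = ∀ u w ws z → let path = u ∷ w ∷ (ws ∷ʳ z) in
  Unique path → Linked (Adj G) path → ¬ Adj G z u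

IsTree : ∀ {n} → Graph n → Set
IsTree G = Connected G × Acyclic G

-- A subtree is represented by its vertex set S. For w in S, the predicate says
-- that v is a neighbour of w in the subtree and that C is the vertex set of the
-- component containing v of the forest obtained from the subtree by deleting w.
IsBranch : ∀ {n} → Graph n → Subset n → Fin n → Fin n → Subset n → Set
IsBranch G S w v C = Adj G w v × v ∈ C × IsComponent G (S - w) C

IsOddComponent : ∀ {n} → Graph n → Subset n → Subset n → Set
IsOddComponent G S C = IsComponent G S C × 2 ∤ ∣ C ∣

data NEBOn {n} (G : Graph n) : Subset n → Fin n → Set where
  single : ∀ {S w} → ∣ S ∣ ≡ 1 → NEBOn G S w
  branch : ∀ {S w} → 2 ℕ.≤ ∣ S ∣ →
           (2 ∣ ∣ S ∣ → ∃! _≡_ (IsOddComponent G (S - w))) →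
           (2 ∤ ∣ S ∣ → ¬ ∃ (IsOddComponent G (S - w))) →
           (∀ v C → IsBranch G S w v C → NEBOn G C v) →
           NEBOn G S w

IsNEB : ∀ {n} → Graph n → Fin n → Set
IsNEB G w = NEBOn G ⊤ w

IsSkewSymmetric : ∀ {n} → Matrix ℝ n → Set
IsSkewSymmetric A = ∀ i j → A j i ≃ -ℝ A i j

graph : ∀ {n} → Matrix ℝ n → Graph n
graph A = record
  { Adj       = λ i j → Edge i j ⊎ Edge j i
  ; symmetric = Sum.swap
  ; loopless  = λ { (inj₁ (i<i , _)) → Fin.<-irrefl refl i<i
                  ; (inj₂ (i<i , _)) → Fin.<-irrefl refl i<i }
  }
  where
  Edge : Rel (Fin _) 0ℓ
  Edge i j = i Fin.< j × ¬ (A i j ≃ 0ℝ)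

infix 4 _∈S⁻_

_∈S⁻_ : ∀ {n} → Matrix ℝ n → Graph n → Set
A ∈S⁻ T = IsSkewSymmetric A × (∀ i j → Adj (graph A) i j ⇔ Adj T i j)

data DuarteOn {n} (A : Matrix ℝ n) : Subset n → Fin n → Set where
  single : ∀ {S w} → ∣ S ∣ ≡ 1 → DuarteOn A S w
  branch : ∀ {S w} → 2 ℕ.≤ ∣ S ∣ →
           ∀ λs μs →
           HasSpectrum (principalSubmatrix A S) λs →
           HasSpectrum (principalSubmatrix A (S - w)) μs →
           μs StrictlyInterlaces λs →
           (∀ v C → IsBranch (graph A) S w v C → DuarteOn A C v) →
           DuarteOn A S w

HasDuarteProperty : ∀ {n} → Matrix ℝ n → Fin n → Set
HasDuarteProperty A w = DuarteOn A ⊤ w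

{-# OPTIONS --safe #-}

-- Suppose that A has the Duarte property on S at w. A skew-symmetric matrix of odd order is
-- singular, so every odd component C of S - w gives a nonzero vector supported in C that is
-- annihilated by A[S - w], because no edge leaves C. Two odd components would give two such
-- vectors with disjoint supports, and two uses of Cramer's rule would then show that z²
-- divides the characteristic polynomial of A[S - w]. This is impossible, as strict
-- interlacing makes the eigenvalues of A[S - w] distinct. Hence S - w has at most one odd
-- component, and by parity it has exactly one when ∣ S ∣ is even and none when ∣ S ∣ is odd.
-- As the goal is a negation, the case distinctions on real numbers and on connectedness
-- are made under ¬ ¬.
module Submission where

open import Defs
open import Algebra.Bundles using (CommutativeRing; Semiring)
open import Algebra.Bundles.Raw using (RawRing)
import Algebra.Definitions.RawSemiring as RawPower
import Algebra.Properties.Group as GroupProperties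
import Algebra.Properties.Ring as RingProperties
import Algebra.Properties.Semiring.Sum as SemiringSum
import Algebra.Solver.Ring.NaturalCoefficients.Default as SemiringSolver
open import Data.Bool.Base using (if_then_else_)
import Data.Bool.Properties as Bool
open import Data.Empty using (⊥; ⊥-elim)
open import Data.Fin.Base as Fin using (Fin; zero; suc; toℕ; inject₁; punchIn; punchOut)
open import Data.Fin.Permutation using (Permutation′; permutation)
import Data.Fin.Properties as Fin
open import Data.Fin.Subset as Subset using (Subset; inside; outside; ∣_∣; _∈_; _∉_; Nonempty)
import Data.Fin.Subset.Properties as Subset
open import Data.Nat.Base as ℕ using (ℕ; zero; suc; _≥_)
open import Data.Nat.Divisibility
  using (_∣_; _∤_; _∣?_; divides; ∣m∣n⇒∣m+n; ∣m+n∣m⇒∣n; ∣-refl; _∣0; ∣1⇒≡1)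
import Data.Nat.Properties as ℕ
open import Data.Product using (∃; ∃!; ∃-syntax; _×_; _,_; proj₁; proj₂)
open import Data.Rational.Base as ℚ using (ℚ; 0ℚ; 1ℚ; ½)
import Data.Rational.Properties as ℚ
open import Data.Rational.Solver using (module +-*-Solver)
open import Data.Sum.Base using (_⊎_; inj₁; inj₂)
open import Data.Vec.Base as Vec using (Vec; []; _∷_)
open import Data.Vec.Functional using (removeAt; updateAt)
open import Data.Vec.Functional.Properties using (updateAt-updates; updateAt-minimal)
import Data.Vec.Properties as Vec
open import Data.Vec.Relation.Unary.All as All using (All; []; _∷_)
open import Data.Vec.Relation.Unary.AllPairs as AllPairs using (AllPairs; []; _∷_)
open import Function.Base using (_∘_; const)
open import Function.Bundles using (_⇔_; mk⇔; Equivalence)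
open import Level using (0ℓ)
open import Relation.Binary.Construct.Closure.ReflexiveTransitive as Star
  using (Star; _◅_; _◅◅_)
open import Relation.Binary.Definitions using (tri<; tri≈; tri>)
open import Relation.Binary.PropositionalEquality as ≡ using (_≡_; _≢_)
import Relation.Binary.Reasoning.Setoid as SetoidReasoning
open import Relation.Nullary using (¬_; Dec; yes; no; does)
open import Relation.Nullary.Decidable
  using (¬¬-excluded-middle; decidable-stable; dec-true; dec-false)

-- Determinants and Cramer's rule

-- The obstacle is that neither equality with 0 nor apartness from 0 can be decided for Cauchy
-- reals. Therefore the linear algebra is developed over a commutative ring in which `Regular`,
-- being cancellable, stands for nonzero, and no element is inverted there: elimination multiplies
-- by the pivot, Cramer's rule is the product identity `cramer`, and z is cancelled from an identity
-- of polynomial functions by way of infinitely many regular points. The ring is later specialised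
-- to ℂ, which has to supply mainly the cancellation of 2 and the alternative "zero or regular"
-- under ¬ ¬. The kernel vector of an odd block comes from eliminating 2 × 2 skew blocks: each
-- elimination keeps the matrix skew and the size odd, so it must end in a row that vanishes on the
-- block. Disjoint supports matter because the first use of Cramer's rule overwrites a column at
-- which the second vector is zero.

swap : ∀ {n} → Fin n → Fin (suc n) → Fin (suc n)
swap zero    zero          = suc zero
swap zero    (suc zero)    = zero
swap zero    (suc (suc k)) = suc (suc k)
swap (suc j) zero          = zero
swap (suc j) (suc k)       = suc (swap j k)

swap-involutive : ∀ {n} (j : Fin n) k → swap j (swap j k) ≡ k
swap-involutive zero    zero          = ≡.refl
swap-involutive zero    (suc zero)    = ≡.refl
swap-involutive zero    (suc (suc k)) = ≡.refl
swap-involutive (suc j) zero          = ≡.refl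
swap-involutive (suc j) (suc k)       = ≡.cong suc (swap-involutive j k)

swap-left : ∀ {n} (j : Fin n) → swap j (inject₁ j) ≡ suc j
swap-left zero    = ≡.refl
swap-left (suc j) = ≡.cong suc (swap-left j)

swap-right : ∀ {n} (j : Fin n) → swap j (suc j) ≡ inject₁ j
swap-right zero    = ≡.refl
swap-right (suc j) = ≡.cong suc (swap-right j)

swap-minimal : ∀ {n} (j : Fin n) k → k ≢ inject₁ j → k ≢ suc j → swap j k ≡ k
swap-minimal zero    zero          k≢ _  = ⊥-elim (k≢ ≡.refl)
swap-minimal zero    (suc zero)    _  k≢ = ⊥-elim (k≢ ≡.refl)
swap-minimal zero    (suc (suc k)) _  _  = ≡.refl
swap-minimal (suc j) zero          _  _  = ≡.refl
swap-minimal (suc j) (suc k) k≢ k≢′ =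
  ≡.cong suc (swap-minimal j k (k≢ ∘ ≡.cong suc) (k≢′ ∘ ≡.cong suc))

-- Deleting one of the two swapped columns from the swapped matrix leaves the same minor as deleting
-- the other from the original; hence in `det-swap` these two terms trade places and only their
-- signs change.
swap-punchIn-right : ∀ {n} (j k : Fin n) →
  swap j (punchIn (suc j) k) ≡ punchIn (inject₁ j) k
swap-punchIn-right zero    zero    = ≡.refl
swap-punchIn-right zero    (suc k) = ≡.refl
swap-punchIn-right (suc j) zero    = ≡.refl
swap-punchIn-right (suc j) (suc k) = ≡.cong suc (swap-punchIn-right j k)

swap-punchIn-left : ∀ {n} (j k : Fin n) →
  swap j (punchIn (inject₁ j) k) ≡ punchIn (suc j) k
swap-punchIn-left j k = ≡.trans
  (≡.cong (swap j) (≡.sym (swap-punchIn-right j k))) (swap-involutive j _)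

-- Once an unaffected column `l` is deleted, the two swapped columns are still neighbours, so the
-- minor undergoes an adjacent swap again. This is what lets `det-swap` recurse.
swap-punchIn-minimal : ∀ {n} (j : Fin (suc n)) l → l ≢ inject₁ j → l ≢ suc j →
  ∃[ j′ ] ∀ k → swap j (punchIn l k) ≡ punchIn l (swap {n} j′ k)
swap-punchIn-minimal zero    zero       l≢ _  = ⊥-elim (l≢ ≡.refl)
swap-punchIn-minimal zero    (suc zero) _  l≢ = ⊥-elim (l≢ ≡.refl)
swap-punchIn-minimal {suc n} zero (suc (suc l)) _ _ = zero , λ where
  zero          → ≡.refl
  (suc zero)    → ≡.refl
  (suc (suc k)) → ≡.refl
swap-punchIn-minimal (suc j) zero _ _ = j , λ _ → ≡.refl
swap-punchIn-minimal {suc n} (suc j) (suc l) l≢ l≢′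
  with swap-punchIn-minimal j l (l≢ ∘ ≡.cong suc) (l≢′ ∘ ≡.cong suc)
... | j′ , commutes = suc j′ , λ where
  zero    → ≡.refl
  (suc k) → ≡.cong suc (commutes k)

swapPermutation : ∀ {n} → Fin n → Permutation′ (suc n)
swapPermutation j = permutation (swap j) (swap j) (swap-involutive j) (swap-involutive j)

module Determinant (R : CommutativeRing 0ℓ 0ℓ) where
  open CommutativeRing R hiding (zero)
  open RingProperties ring using (-1*x≈-x; -‿involutive)
  open SemiringSum semiring using (sum; sum-cong-≋; ∑-distrib-+; sum-permute; *-distribˡ-sum)
  open RawPower (Semiring.rawSemiring semiring) using (_^_)
  open SetoidReasoning setoid

  private
    D : ∀ {n} → Matrix Carrier n → Carrier
    D = det rawRing

    minor : ∀ {n} → Matrix Carrier (suc n) → Fin (suc n) → Matrix Carrier n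
    minor M j i = removeAt (M (suc i)) j

    term : ∀ {n} → Matrix Carrier (suc n) → Fin (suc n) → Carrier
    term M j = ((- 1#) ^ toℕ j * M zero j) * D (minor M j)

  sum-neg : ∀ {n} (f : Fin n → Carrier) → sum (λ i → - f i) ≈ - sum f
  sum-neg f = begin
    sum (λ i → - f i)        ≈⟨ sum-cong-≋ (λ i → sym (-1*x≈-x (f i))) ⟩
    sum (λ i → - 1# * f i)   ≈⟨ sym (*-distribˡ-sum (- 1#) f) ⟩
    - 1# * sum f             ≈⟨ -1*x≈-x (sum f) ⟩
    - sum f                  ∎

  sum-zero : ∀ {n} (f : Fin n → Carrier) → (∀ i → f i ≈ 0#) → sum f ≈ 0#
  sum-zero {zero}  f f≈0 = refl
  sum-zero {suc n} f f≈0 =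
    trans (+-cong (f≈0 zero) (sum-zero (f ∘ suc) (f≈0 ∘ suc))) (+-identityˡ 0#)

  sum-single : ∀ {n} (f : Fin n → Carrier) k → (∀ i → i ≢ k → f i ≈ 0#) → sum f ≈ f k
  sum-single {suc n} f zero    f≈0 = trans
    (+-congˡ (sum-zero (f ∘ suc) (λ i → f≈0 (suc i) λ ()))) (+-identityʳ _)
  sum-single {suc n} f (suc k) f≈0 = trans
    (+-cong (f≈0 zero λ ()) (sum-single (f ∘ suc) k (λ i i≢k → f≈0 (suc i) (i≢k ∘ Fin.suc-injective))))
    (+-identityˡ _)

  det-cong : ∀ {n} {M N : Matrix Carrier n} → (∀ i j → M i j ≈ N i j) → D M ≈ D N
  det-cong {zero}  M≈N = refl
  det-cong {suc n} M≈N = sum-cong-≋ λ j →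
    *-cong (*-congˡ {(- 1#) ^ toℕ j} (M≈N zero j)) (det-cong λ i k → M≈N (suc i) (punchIn j k))

  -- The matrices are related by hypotheses rather than by column updates, so that their minors
  -- satisfy the same hypotheses: deleting a column `j ≢ k` moves column `k` to `punchOut j≢k`, and
  -- deleting column `k` makes all three minors equal.
  det-linear : ∀ {n} k c (M N P : Matrix Carrier n) →
    (∀ i → P i k ≈ c * M i k + N i k) →
    (∀ i j → j ≢ k → P i j ≈ M i j) →
    (∀ i j → j ≢ k → P i j ≈ N i j) →
    D P ≈ c * D M + D N
  det-linear {suc n} k c M N P at-k M-off N-off = begin
    sum (term P)                               ≈⟨ sum-cong-≋ linear ⟩
    sum (λ j → c * term M j + term N j)        ≈⟨ ∑-distrib-+ (λ j → c * term M j) (term N) ⟩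
    sum (λ j → c * term M j) + sum (term N)    ≈⟨ +-congʳ (sym (*-distribˡ-sum c (term M))) ⟩
    c * sum (term M) + sum (term N)            ∎
    where
    open SemiringSolver commutativeSemiring
    linear : ∀ j → term P j ≈ c * term M j + term N j
    linear j with j Fin.≟ k
    ... | yes ≡.refl = begin
      s * P zero j * D (minor P j)
        ≈⟨ *-congʳ (*-congˡ (at-k zero)) ⟩
      s * (c * M zero j + N zero j) * D (minor P j)
        ≈⟨ solve 5 (λ s c m n d → s :* (c :* m :+ n) :* d := c :* (s :* m :* d) :+ s :* n :* d)
             refl s c (M zero j) (N zero j) (D (minor P j)) ⟩
      c * (s * M zero j * D (minor P j)) + s * N zero j * D (minor P j)
        ≈⟨ +-cong
             (*-congˡ (*-congˡ (det-cong λ i l → M-off (suc i) (punchIn j l) (Fin.punchInᵢ≢i j l))))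
             (*-congˡ (det-cong λ i l → N-off (suc i) (punchIn j l) (Fin.punchInᵢ≢i j l))) ⟩
      c * term M j + term N j ∎
      where s = (- 1#) ^ toℕ j
    ... | no j≢k = begin
      s * P zero j * D (minor P j)
        ≈⟨ *-congˡ minors ⟩
      s * P zero j * (c * D (minor M j) + D (minor N j))
        ≈⟨ solve 5 (λ s p c m n → s :* p :* (c :* m :+ n) := c :* (s :* p :* m) :+ s :* p :* n)
             refl s (P zero j) c (D (minor M j)) (D (minor N j)) ⟩
      c * (s * P zero j * D (minor M j)) + s * P zero j * D (minor N j)
        ≈⟨ +-cong (*-congˡ (*-congʳ (*-congˡ (M-off zero j j≢k)))) (*-congʳ (*-congˡ (N-off zero j j≢k))) ⟩
      c * term M j + term N j ∎
      where
      s = (- 1#) ^ toℕ j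
      k′ = punchOut j≢k
      k′↦k : punchIn j k′ ≡ k
      k′↦k = Fin.punchIn-punchOut j≢k
      off : ∀ {l} → l ≢ k′ → punchIn j l ≢ k
      off l≢k′ eq = l≢k′ (Fin.punchIn-injective j _ _ (≡.trans eq (≡.sym k′↦k)))
      minors : D (minor P j) ≈ c * D (minor M j) + D (minor N j)
      minors = det-linear k′ c (minor M j) (minor N j) (minor P j)
        (λ i → ≡.subst (λ l → P (suc i) l ≈ c * M (suc i) l + N (suc i) l) (≡.sym k′↦k) (at-k (suc i)))
        (λ i l l≢ → M-off (suc i) (punchIn j l) (off l≢))
        (λ i l l≢ → N-off (suc i) (punchIn j l) (off l≢))

  -- Reindexing the expansion by the swap itself lines up equal minors. At the two swapped columns
  -- the exponents of `- 1#` differ by one; elsewhere the minor is negated by induction.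
  det-swap : ∀ {n} (j : Fin n) (M : Matrix Carrier (suc n)) →
    D (λ i k → M i (swap j k)) ≈ - D M
  det-swap {suc n} j M = begin
    sum (term N)                     ≈⟨ sum-permute (term N) (swapPermutation j) ⟩
    sum (λ l → term N (swap j l))    ≈⟨ sum-cong-≋ swapped ⟩
    sum (λ l → - term M l)           ≈⟨ sum-neg (term M) ⟩
    - sum (term M)                   ∎
    where
    N : Matrix Carrier (suc (suc n))
    N i k = M i (swap j k)

    open SemiringSolver commutativeSemiring using (solve; _:=_; _:*_)

    negate-sign : ∀ s m d → ((- 1# * s) * m) * d ≈ - ((s * m) * d)
    negate-sign s m d = trans
      (solve 4 (λ t s m d → t :* s :* m :* d := t :* (s :* m :* d)) refl (- 1#) s m d)
      (-1*x≈-x _)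

    entries : ∀ l {l′} → swap j l ≡ l′ → (t : Carrier) →
      (∀ k → swap j (punchIn l′ k) ≡ punchIn l k) →
      (t * N zero l′) * D (minor N l′) ≈ (t * M zero l) * D (minor M l)
    entries l ≡.refl t columns = *-cong
      (*-congˡ (reflexive (≡.cong (M zero) (swap-involutive j l))))
      (det-cong λ i k → reflexive (≡.cong (M (suc i)) (columns k)))

    swapped : ∀ l → term N (swap j l) ≈ - term M l
    swapped l with l Fin.≟ inject₁ j | l Fin.≟ suc j
    ... | yes ≡.refl | _ rewrite swap-left j = begin
      ((- 1# * (- 1#) ^ toℕ j) * N zero (suc j)) * D (minor N (suc j))
        ≈⟨ entries (inject₁ j) (swap-left j) _ (swap-punchIn-right j) ⟩
      ((- 1# * (- 1#) ^ toℕ j) * M zero (inject₁ j)) * D (minor M (inject₁ j))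
        ≈⟨ negate-sign _ _ _ ⟩
      - (((- 1#) ^ toℕ j * M zero (inject₁ j)) * D (minor M (inject₁ j)))
        ≡⟨ ≡.cong (λ e → - (((- 1#) ^ e * M zero (inject₁ j)) * D (minor M (inject₁ j))))
             (≡.sym (Fin.toℕ-inject₁ j)) ⟩
      - term M (inject₁ j) ∎
    ... | no _ | yes ≡.refl rewrite swap-right j = begin
      ((- 1#) ^ toℕ (inject₁ j) * N zero (inject₁ j)) * D (minor N (inject₁ j))
        ≈⟨ entries (suc j) (swap-right j) _ (swap-punchIn-left j) ⟩
      ((- 1#) ^ toℕ (inject₁ j) * M zero (suc j)) * D (minor M (suc j))
        ≡⟨ ≡.cong (λ e → ((- 1#) ^ e * M zero (suc j)) * D (minor M (suc j))) (Fin.toℕ-inject₁ j) ⟩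
      ((- 1#) ^ toℕ j * M zero (suc j)) * D (minor M (suc j))
        ≈⟨ sym (-‿involutive _) ⟩
      - - (((- 1#) ^ toℕ j * M zero (suc j)) * D (minor M (suc j)))
        ≈⟨ -‿cong (sym (negate-sign _ _ _)) ⟩
      - term M (suc j) ∎
    ... | no l≢ | no l≢′ rewrite swap-minimal j l l≢ l≢′ = begin
      ((- 1#) ^ toℕ l * N zero l) * D (minor N l)
        ≈⟨ *-cong (*-congˡ (reflexive (≡.cong (M zero) (swap-minimal j l l≢ l≢′)))) minors ⟩
      ((- 1#) ^ toℕ l * M zero l) * - D (minor M l)
        ≈⟨ *-congˡ (sym (-1*x≈-x _)) ⟩
      ((- 1#) ^ toℕ l * M zero l) * (- 1# * D (minor M l))
        ≈⟨ solve 3 (λ t m d → m :* (t :* d) := t :* (m :* d)) refl (- 1#) _ _ ⟩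
      - 1# * term M l
        ≈⟨ -1*x≈-x _ ⟩
      - term M l ∎
      where
      commuting = swap-punchIn-minimal j l l≢ l≢′
      minors : D (minor N l) ≈ - D (minor M l)
      minors = trans
        (det-cong λ i k → reflexive (≡.cong (M (suc i)) (proj₂ commuting k)))
        (det-swap (proj₁ commuting) (minor M l))

  module Alternating (halve : ∀ x → x + x ≈ 0# → x ≈ 0#) where

    -- Induction on the number `d` of columns between `a` and `b`. For neighbours the swap leaves
    -- `M` unchanged, so `D M ≈ - D M` and `halve` applies; otherwise a swap moves the right column
    -- one place to the left.
    det-equalColumnsAt : ∀ {n} d (M : Matrix Carrier n) a b → toℕ b ≡ suc (d ℕ.+ toℕ a) →
      (∀ i → M i a ≈ M i b) → D M ≈ 0#
    det-equalColumnsAt zero M a (suc j) b≡ Ma≈Mb = halve (D M) (begin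
      D M + D M                           ≈⟨ +-congˡ (det-cong unchanged) ⟩
      D M + D (λ i k → M i (swap j k))    ≈⟨ +-congˡ (det-swap j M) ⟩
      D M + - D M                         ≈⟨ -‿inverseʳ (D M) ⟩
      0#                                  ∎)
      where
      a≡ : a ≡ inject₁ j
      a≡ = Fin.toℕ-injective (≡.trans (≡.sym (ℕ.suc-injective b≡)) (≡.sym (Fin.toℕ-inject₁ j)))
      equal : ∀ i → M i (inject₁ j) ≈ M i (suc j)
      equal i = ≡.subst (λ c → M i c ≈ M i (suc j)) a≡ (Ma≈Mb i)
      unchanged : ∀ i k → M i k ≈ M i (swap j k)
      unchanged i k with k Fin.≟ inject₁ j | k Fin.≟ suc j
      ... | yes ≡.refl | _ rewrite swap-left j = equal i
      ... | no _ | yes ≡.refl rewrite swap-right j = sym (equal i)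
      ... | no k≢ | no k≢′ rewrite swap-minimal j k k≢ k≢′ = refl
    det-equalColumnsAt (suc d) M a (suc j) b≡ Ma≈Mb = begin
      D M                              ≈⟨ sym (-‿involutive (D M)) ⟩
      - - D M                          ≈⟨ -‿cong (sym (det-swap j M)) ⟩
      - D (λ i k → M i (swap j k))     ≈⟨ -‿cong swapped≈0 ⟩
      - 0#                             ≈⟨ RingProperties.-0#≈0# ring ⟩
      0#                               ∎
      where
      a<j : toℕ a ℕ.< toℕ j
      a<j = ℕ.≤-trans (ℕ.s≤s (ℕ.m≤n+m (toℕ a) d)) (ℕ.≤-reflexive (≡.sym (ℕ.suc-injective b≡)))
      a≢left : a ≢ inject₁ j
      a≢left eq = ℕ.<⇒≢ a<j (≡.trans (≡.cong toℕ eq) (Fin.toℕ-inject₁ j))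
      a≢right : a ≢ suc j
      a≢right eq = ℕ.<⇒≢ (ℕ.m<n⇒m<1+n a<j) (≡.cong toℕ eq)
      swapped≈0 : D (λ i k → M i (swap j k)) ≈ 0#
      swapped≈0 = det-equalColumnsAt d (λ i k → M i (swap j k)) a (inject₁ j)
        (≡.trans (Fin.toℕ-inject₁ j) (ℕ.suc-injective b≡))
        (λ i → trans (reflexive (≡.cong (M i) (swap-minimal j a a≢left a≢right)))
          (trans (Ma≈Mb i) (reflexive (≡.cong (M i) (≡.sym (swap-left j))))))

    det-equalColumns : ∀ {n} (M : Matrix Carrier n) a b → a ≢ b →
      (∀ i → M i a ≈ M i b) → D M ≈ 0#
    det-equalColumns M a b a≢b Ma≈Mb with ℕ.<-cmp (toℕ a) (toℕ b)
    ... | tri≈ _ eq _ = ⊥-elim (a≢b (Fin.toℕ-injective eq))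
    ... | tri< a<b _ _ = det-equalColumnsAt (toℕ b ℕ.∸ suc (toℕ a)) M a b
      (≡.trans (≡.sym (ℕ.m∸n+n≡m a<b)) (ℕ.+-suc _ _)) Ma≈Mb
    ... | tri> _ _ b<a = det-equalColumnsAt (toℕ a ℕ.∸ suc (toℕ b)) M b a
      (≡.trans (≡.sym (ℕ.m∸n+n≡m b<a)) (ℕ.+-suc _ _)) (sym ∘ Ma≈Mb)

    infixl 30 _[_≔_]
    _[_≔_] : ∀ {n} → Matrix Carrier n → Fin n → (Fin n → Carrier) → Matrix Carrier n
    (M [ k ≔ v ]) i = updateAt (M i) k (const (v i))

    replaced-at : ∀ {n} (M : Matrix Carrier n) k v i → (M [ k ≔ v ]) i k ≈ v i
    replaced-at M k v i = reflexive (updateAt-updates k (M i))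

    replaced-off : ∀ {n} (M : Matrix Carrier n) k v i j → j ≢ k → (M [ k ≔ v ]) i j ≈ M i j
    replaced-off M k v i j j≢k = reflexive (updateAt-minimal j k (M i) j≢k)

    replaced-off₂ : ∀ {n} (M : Matrix Carrier n) k u v i j → j ≢ k →
      (M [ k ≔ u ]) i j ≈ (M [ k ≔ v ]) i j
    replaced-off₂ M k u v i j j≢k =
      trans (replaced-off M k u i j j≢k) (sym (replaced-off M k v i j j≢k))

    replaced-cong : ∀ {n} (M : Matrix Carrier n) k {u v} → (∀ i → u i ≈ v i) →
      D (M [ k ≔ u ]) ≈ D (M [ k ≔ v ])
    replaced-cong M k {u} {v} u≈v = det-cong entry
      where
      entry : ∀ i j → (M [ k ≔ u ]) i j ≈ (M [ k ≔ v ]) i j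
      entry i j with j Fin.≟ k
      ... | yes ≡.refl = trans (replaced-at M j u i) (trans (u≈v i) (sym (replaced-at M j v i)))
      ... | no j≢k = replaced-off₂ M k u v i j j≢k

    det-column-+ : ∀ {n} (M : Matrix Carrier n) k c u v →
      D (M [ k ≔ (λ i → c * u i + v i) ]) ≈ c * D (M [ k ≔ u ]) + D (M [ k ≔ v ])
    det-column-+ M k c u v = det-linear k c _ _ _
      (λ i → trans (replaced-at M k (λ i → c * u i + v i) i)
        (sym (+-cong (*-congˡ (replaced-at M k u i)) (replaced-at M k v i))))
      (replaced-off₂ M k _ _) (replaced-off₂ M k _ _)

    det-column-0 : ∀ {n} (M : Matrix Carrier n) k → D (M [ k ≔ const 0# ]) ≈ 0#
    det-column-0 M k = RingProperties.x+x≈x⇒x≈0 ring d (begin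
      d + d                  ≈⟨ +-congʳ (sym (*-identityˡ d)) ⟩
      1# * d + d             ≈⟨ sym (det-column-+ M k 1# (const 0#) (const 0#)) ⟩
      D (M [ k ≔ const (1# * 0# + 0#) ])
                             ≈⟨ replaced-cong M k (λ _ → trans (+-identityʳ _) (zeroʳ 1#)) ⟩
      d                      ∎)
      where d = D (M [ k ≔ const 0# ])

    det-column-* : ∀ {n} (M : Matrix Carrier n) k c u →
      D (M [ k ≔ (λ i → c * u i) ]) ≈ c * D (M [ k ≔ u ])
    det-column-* M k c u = begin
      D (M [ k ≔ (λ i → c * u i) ])                  ≈⟨ replaced-cong M k (λ i → sym (+-identityʳ (c * u i))) ⟩
      D (M [ k ≔ (λ i → c * u i + 0#) ])             ≈⟨ det-column-+ M k c u (const 0#) ⟩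
      c * D (M [ k ≔ u ]) + D (M [ k ≔ const 0# ])   ≈⟨ +-congˡ (det-column-0 M k) ⟩
      c * D (M [ k ≔ u ]) + 0#                       ≈⟨ +-identityʳ _ ⟩
      c * D (M [ k ≔ u ])                            ∎

    det-column-sum : ∀ {m n} (M : Matrix Carrier n) k (c : Fin m → Carrier) (v : Fin m → Fin n → Carrier) →
      D (M [ k ≔ (λ i → sum λ j → c j * v j i) ]) ≈ sum λ j → c j * D (M [ k ≔ v j ])
    det-column-sum {zero}  M k c v = det-column-0 M k
    det-column-sum {suc m} M k c v = trans
      (det-column-+ M k (c zero) (v zero) _)
      (+-congˡ (det-column-sum M k (c ∘ suc) (v ∘ suc)))

    _·_ : ∀ {n} → Matrix Carrier n → (Fin n → Carrier) → Fin n → Carrier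
    (M · x) i = sum λ j → M i j * x j

    -- By linearity in column `k`, the right side is a sum of `x j` times the determinant with
    -- column `j` copied into column `k`; every term with `j ≢ k` has two equal columns. Stated
    -- without a quotient, the rule also covers singular `M`.
    cramer : ∀ {n} (M : Matrix Carrier n) x k → x k * D M ≈ D (M [ k ≔ M · x ])
    cramer M x k = sym (begin
      D (M [ k ≔ M · x ])
        ≈⟨ replaced-cong M k (λ i → sum-cong-≋ λ j → *-comm (M i j) (x j)) ⟩
      D (M [ k ≔ (λ i → sum λ j → x j * M i j) ])
        ≈⟨ det-column-sum M k x (λ j i → M i j) ⟩
      sum (λ j → x j * D (M [ k ≔ (λ i → M i j) ]))
        ≈⟨ sum-single _ k (λ j j≢k → trans (*-congˡ (det-equalColumns _ j k j≢k (equal j j≢k))) (zeroʳ (x j))) ⟩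
      x k * D (M [ k ≔ (λ i → M i k) ])
        ≈⟨ *-congˡ (det-cong same) ⟩
      x k * D M ∎)
      where
      equal : ∀ j → j ≢ k → ∀ i → (M [ k ≔ (λ i → M i j) ]) i j ≈ (M [ k ≔ (λ i → M i j) ]) i k
      equal j j≢k i = trans (replaced-off M k (λ i → M i j) i j j≢k) (sym (replaced-at M k (λ i → M i j) i))
      same : ∀ i j → (M [ k ≔ (λ i → M i k) ]) i j ≈ M i j
      same i j with j Fin.≟ k
      ... | yes ≡.refl = replaced-at M j (λ i → M i j) i
      ... | no j≢k = replaced-off M k (λ i → M i k) i j j≢k

-- Polynomial functions

module PolynomialFunctions (R : CommutativeRing 0ℓ 0ℓ) where
  open CommutativeRing R hiding (zero)
  open RingProperties ring using (-1*x≈-x; -0#≈0#)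
  open GroupProperties +-group using (x∙y⁻¹≈ε⇒x≈y; x≈y⇒x∙y⁻¹≈ε)
  open SemiringSum semiring using (sum)
  open RawPower (Semiring.rawSemiring semiring) using (_^_)
  open SetoidReasoning setoid
  open SemiringSolver commutativeSemiring using (solve; _:=_; _:*_; _:+_)

  -- Nonzero in the form that the ring arguments use. It asks for no inverse and passes to products
  -- at once.
  Regular : Carrier → Set
  Regular c = ∀ w → c * w ≈ 0# → w ≈ 0#

  regular-resp : ∀ {c d} → c ≈ d → Regular c → Regular d
  regular-resp c≈d reg w dw≈0 = reg w (trans (*-congʳ c≈d) dw≈0)

  regular-* : ∀ {c d} → Regular c → Regular d → Regular (c * d)
  regular-* reg-c reg-d w cdw≈0 = reg-d w (reg-c _ (trans (sym (*-assoc _ _ w)) cdw≈0))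

  regular-neg : ∀ {c} → Regular c → Regular (- c)
  regular-neg {c} reg w -cw≈0 = reg w (begin
    c * w            ≈⟨ sym (RingProperties.-‿involutive ring (c * w)) ⟩
    - - (c * w)      ≈⟨ -‿cong (RingProperties.-‿distribˡ-* ring c w) ⟩
    - (- c * w)      ≈⟨ -‿cong -cw≈0 ⟩
    - 0#             ≈⟨ -0#≈0# ⟩
    0#               ∎)

  regular-cancel : ∀ {c} → Regular c → ∀ {x y} → c * x ≈ c * y → x ≈ y
  regular-cancel {c} reg {x} {y} cx≈cy = x∙y⁻¹≈ε⇒x≈y _ _ (reg (x - y)
    (trans (RingProperties.x[y-z]≈xy-xz ring c x y) (x≈y⇒x∙y⁻¹≈ε cx≈cy)))

  -- f agrees with a polynomial with d coefficients, in Horner form.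
  Polynomial : ℕ → (Carrier → Carrier) → Set
  Polynomial zero    f = ∀ z → f z ≈ 0#
  Polynomial (suc d) f = ∃[ a ] ∃[ g ] Polynomial d g × (∀ z → f z ≈ a + z * g z)

  polynomial-0 : ∀ d → Polynomial d (const 0#)
  polynomial-0 zero    z = refl
  polynomial-0 (suc d) = 0# , const 0# , polynomial-0 d , λ z →
    sym (trans (+-identityˡ _) (zeroʳ z))

  polynomial-resp : ∀ d {f g} → (∀ z → f z ≈ g z) → Polynomial d f → Polynomial d g
  polynomial-resp zero    f≈g f≈0 z = trans (sym (f≈g z)) (f≈0 z)
  polynomial-resp (suc d) f≈g (a , h , ph , f≈) = a , h , ph , λ z → trans (sym (f≈g z)) (f≈ z)

  -- The index only bounds the number of coefficients, since a leading coefficient could not be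
  -- tested for zero; polynomials of different length are padded to a common bound.
  polynomial-raise : ∀ e {d f} → Polynomial d f → Polynomial (d ℕ.+ e) f
  polynomial-raise e {zero}  f≈0 = polynomial-resp e (sym ∘ f≈0) (polynomial-0 e)
  polynomial-raise e {suc d} (a , g , pg , f≈) = a , g , polynomial-raise e pg , f≈

  polynomial-+ : ∀ d {f g} → Polynomial d f → Polynomial d g → Polynomial d (λ z → f z + g z)
  polynomial-+ zero    f≈0 g≈0 z = trans (+-cong (f≈0 z) (g≈0 z)) (+-identityˡ 0#)
  polynomial-+ (suc d) (a , f′ , pf , f≈) (b , g′ , pg , g≈) =
    a + b , (λ z → f′ z + g′ z) , polynomial-+ d pf pg , λ z →
      trans (+-cong (f≈ z) (g≈ z))
        (solve 5 (λ a b z f g → a :+ z :* f :+ (b :+ z :* g) := a :+ b :+ z :* (f :+ g))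
          refl a b z (f′ z) (g′ z))

  polynomial-scale : ∀ d c {f} → Polynomial d f → Polynomial d (λ z → c * f z)
  polynomial-scale zero    c f≈0 z = trans (*-congˡ (f≈0 z)) (zeroʳ c)
  polynomial-scale (suc d) c (a , g , pg , f≈) =
    c * a , (λ z → c * g z) , polynomial-scale d c pg , λ z →
      trans (*-congˡ (f≈ z))
        (solve 4 (λ c a z g → c :* (a :+ z :* g) := c :* a :+ z :* (c :* g)) refl c a z (g z))

  polynomial-z* : ∀ d {f} → Polynomial d f → Polynomial (suc d) (λ z → z * f z)
  polynomial-z* d {f} pf = 0# , f , pf , λ z → sym (+-identityˡ _)

  polynomial-* : ∀ d e {f g} → Polynomial d f → Polynomial e g →
    Polynomial (d ℕ.+ e) (λ z → f z * g z)
  polynomial-* zero    e {f} {g} f≈0 pg =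
    polynomial-resp e (λ z → sym (trans (*-congʳ (f≈0 z)) (zeroˡ (g z)))) (polynomial-0 e)
  polynomial-* (suc d) e {f} {g} (a , f′ , pf , f≈) pg = polynomial-resp (suc d ℕ.+ e)
    (λ z → sym (trans (*-congʳ (f≈ z))
      (solve 4 (λ a z f g → (a :+ z :* f) :* g := a :* g :+ z :* (f :* g)) refl a z (f′ z) (g z))))
    (polynomial-+ (suc d ℕ.+ e)
      (≡.subst (λ m → Polynomial m (λ z → a * g z)) (ℕ.+-comm e (suc d))
        (polynomial-raise (suc d) (polynomial-scale e a pg)))
      (polynomial-z* (d ℕ.+ e) (polynomial-* d e pf pg)))

  IsPolynomial : (Carrier → Carrier) → Set
  IsPolynomial f = ∃[ d ] Polynomial d f

  isPolynomial-resp : ∀ {f g} → (∀ z → f z ≈ g z) → IsPolynomial f → IsPolynomial g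
  isPolynomial-resp f≈g (d , pf) = d , polynomial-resp d f≈g pf

  isPolynomial-const : ∀ c → IsPolynomial (const c)
  isPolynomial-const c = 1 , c , const 0# , polynomial-0 0 , λ z →
    sym (trans (+-congˡ (zeroʳ z)) (+-identityʳ c))

  isPolynomial-id : IsPolynomial (λ z → z)
  isPolynomial-id with d , p ← isPolynomial-const 1# =
    suc d , polynomial-resp (suc d) (λ z → *-identityʳ z) (polynomial-z* d p)

  isPolynomial-+ : ∀ {f g} → IsPolynomial f → IsPolynomial g → IsPolynomial (λ z → f z + g z)
  isPolynomial-+ {g = g} (d , pf) (e , pg) = d ℕ.+ e , polynomial-+ (d ℕ.+ e)
    (polynomial-raise e pf)
    (≡.subst (λ m → Polynomial m g) (ℕ.+-comm e d) (polynomial-raise d pg))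

  isPolynomial-* : ∀ {f g} → IsPolynomial f → IsPolynomial g → IsPolynomial (λ z → f z * g z)
  isPolynomial-* (d , pf) (e , pg) = d ℕ.+ e , polynomial-* d e pf pg

  isPolynomial-neg : ∀ {f} → IsPolynomial f → IsPolynomial (λ z → - f z)
  isPolynomial-neg {f} (d , pf) =
    d , polynomial-resp d (λ z → -1*x≈-x (f z)) (polynomial-scale d (- 1#) pf)

  isPolynomial-sum : ∀ {n} (f : Fin n → Carrier → Carrier) → (∀ i → IsPolynomial (f i)) →
    IsPolynomial (λ z → sum (λ i → f i z))
  isPolynomial-sum {zero}  f pf = isPolynomial-const 0#
  isPolynomial-sum {suc n} f pf =
    isPolynomial-+ (pf zero) (isPolynomial-sum (f ∘ suc) (pf ∘ suc))

  isPolynomial-det : ∀ {n} (M : Carrier → Matrix Carrier n) →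
    (∀ i j → IsPolynomial (λ z → M z i j)) → IsPolynomial (λ z → det rawRing (M z))
  isPolynomial-det {zero}  M pM = isPolynomial-const 1#
  isPolynomial-det {suc n} M pM = isPolynomial-sum
    (λ j z → ((- 1#) ^ toℕ j * M z zero j) * det rawRing (λ i → removeAt (M z (suc i)) j))
    λ j → isPolynomial-* (isPolynomial-* (isPolynomial-const ((- 1#) ^ toℕ j)) (pM zero j))
      (isPolynomial-det (λ z i → removeAt (M z (suc i)) j) (λ i k → pM (suc i) (punchIn j k)))

  -- Synthetic division: if `g z ≈ g r + (z - r) * h z`, then writing `z` as `(z - r) + r` shows
  -- that `a + z * g z` has quotient `g z + r * h z`.
  factor : ∀ d {f} → Polynomial (suc d) f → ∀ r →
    ∃[ h ] Polynomial d h × (∀ z → f z ≈ f r + (z - r) * h z)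
  factor zero {f} (a , g , g≈0 , f≈) r = const 0# , (λ _ → refl) , λ z → begin
    f z                    ≈⟨ constant-a z ⟩
    a                      ≈⟨ sym (constant-a r) ⟩
    f r                    ≈⟨ sym (+-identityʳ (f r)) ⟩
    f r + 0#               ≈⟨ +-congˡ (sym (zeroʳ (z - r))) ⟩
    f r + (z - r) * 0#     ∎
    where
    constant-a : ∀ z → f z ≈ a
    constant-a z = trans (f≈ z) (trans (+-congˡ (trans (*-congˡ (g≈0 z)) (zeroʳ z))) (+-identityʳ a))
  factor (suc d) {f} (a , g , pg , f≈) r with factor d pg r
  ... | h , ph , g≈ = (λ z → g z + r * h z) , polynomial-+ (suc d) pg
      (≡.subst (λ m → Polynomial m (λ z → r * h z)) (ℕ.+-comm d 1)
        (polynomial-raise 1 (polynomial-scale d r ph))) , λ z → begin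
    f z
      ≈⟨ f≈ z ⟩
    a + z * g z
      ≈⟨ +-congˡ (*-congʳ (sym (shifted z))) ⟩
    a + ((z - r) + r) * g z
      ≈⟨ solve 4 (λ a w r g → a :+ (w :+ r) :* g := a :+ r :* g :+ w :* g) refl a (z - r) r (g z) ⟩
    a + r * g z + (z - r) * g z
      ≈⟨ +-congʳ (+-congˡ (*-congˡ (g≈ z))) ⟩
    a + r * (g r + (z - r) * h z) + (z - r) * g z
      ≈⟨ solve 6 (λ a r s w h g → a :+ r :* (s :+ w :* h) :+ w :* g := a :+ r :* s :+ w :* (g :+ r :* h))
           refl a r (g r) (z - r) (h z) (g z) ⟩
    a + r * g r + (z - r) * (g z + r * h z)
      ≈⟨ +-congʳ (sym (f≈ r)) ⟩
    f r + (z - r) * (g z + r * h z) ∎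
    where
    shifted : ∀ z → (z - r) + r ≈ z
    shifted z = trans (+-assoc z (- r) r) (trans (+-congˡ (-‿inverseˡ r)) (+-identityʳ z))

  module Roots
    (point : ℕ → Carrier)
    (point-regular : ∀ k → Regular (point k))
    (points-apart : ∀ {j k} → j ℕ.< k → Regular (point k - point j))
    where

    -- `point m` is split off as a root; the quotient vanishes at all later points because their
    -- differences from `point m` are regular. Thus the starting index `m` advances while the number
    -- of coefficients drops.
    vanishes : ∀ d {f} → Polynomial d f → ∀ m →
      (∀ k → m ℕ.≤ k → f (point k) ≈ 0#) → ∀ z → f z ≈ 0#
    vanishes zero    f≈0 m roots z = f≈0 z
    vanishes (suc d) {f} pf m roots z with factor d pf (point m)
    ... | h , ph , f≈ = trans (f≈′ z) (trans (*-congˡ (h≈0 z)) (zeroʳ _))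
      where
      f≈′ : ∀ z → f z ≈ (z - point m) * h z
      f≈′ z = trans (f≈ z) (trans (+-congʳ (roots m ℕ.≤-refl)) (+-identityˡ _))
      h≈0 : ∀ z → h z ≈ 0#
      h≈0 = vanishes d ph (suc m) λ k m<k → points-apart m<k (h (point k))
        (trans (sym (f≈′ (point k))) (roots k (ℕ.<⇒≤ m<k)))

    -- At a given `z`, in particular at 0, the factor need not be cancellable. It is cancelled at
    -- the regular points, and the polynomial `f - g`, vanishing at all of them, vanishes
    -- everywhere.
    cancel-z : ∀ {f g} → IsPolynomial f → IsPolynomial g →
      (∀ z → z * f z ≈ z * g z) → ∀ z → f z ≈ g z
    cancel-z pf pg zf≈zg z with isPolynomial-+ pf (isPolynomial-neg pg)
    ... | d , p = x∙y⁻¹≈ε⇒x≈y _ _ (vanishes d p 0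
      (λ k _ → x≈y⇒x∙y⁻¹≈ε (regular-cancel (point-regular k) (zf≈zg (point k)))) z)

    module _
      (regular-or-zero : ∀ x → ¬ ¬ (x ≈ 0# ⊎ Regular x))
      (1≉0 : ¬ (1# ≈ 0#))
      {T : Set} (ι : T → Carrier)
      where

      rootProduct : ∀ {m} → Vec T m → Carrier → Carrier
      rootProduct ts z = Vec.foldr′ (λ t p → (z - ι t) * p) 1# ts

      isPolynomial-rootProduct : ∀ {m} (ts : Vec T m) → IsPolynomial (rootProduct ts)
      isPolynomial-rootProduct []       = isPolynomial-const 1#
      isPolynomial-rootProduct (t ∷ ts) = isPolynomial-*
        (isPolynomial-+ isPolynomial-id (isPolynomial-const (- ι t))) (isPolynomial-rootProduct ts)

      regular-0-t : ∀ {t} → Regular (ι t) → Regular (0# - ι t)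
      regular-0-t reg = regular-resp (sym (+-identityˡ _)) (regular-neg reg)

      rootProduct-regular : ∀ {m} {ts : Vec T m} → All (Regular ∘ ι) ts → Regular (rootProduct ts 0#)
      rootProduct-regular []         w 1w≈0 = trans (sym (*-identityˡ w)) 1w≈0
      rootProduct-regular (reg ∷ regs) = regular-* (regular-0-t reg) (rootProduct-regular regs)

      regular≉0 : ∀ {c} → Regular c → ¬ (c ≈ 0#)
      regular≉0 reg c≈0 = 1≉0 (reg 1# (trans (*-identityʳ _) c≈0))

      -- The accumulator `c` collects the factors of roots found regular, so `c 0#` stays regular.
      -- At the first zero root the later ones are regular by the pairwise hypothesis; one `z` is
      -- then cancelled, and evaluation at 0 makes a regular element zero. If no root is zero,
      -- evaluation at 0 suffices by itself.
      noDoubleRoot : ∀ {m} (ts : Vec T m) →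
        AllPairs (λ s t → ι s ≈ 0# → Regular (ι t)) ts →
        ∀ {c q} → IsPolynomial c → IsPolynomial q → Regular (c 0#) →
        ¬ (∀ z → c z * rootProduct ts z ≈ z * (z * q z))
      noDoubleRoot [] [] {c} pc pq reg eq = regular≉0 reg
        (trans (sym (*-identityʳ _)) (trans (eq 0#) (zeroˡ _)))
      noDoubleRoot (t ∷ ts) (apart ∷ distinct) {c} {q} pc pq reg eq = regular-or-zero (ι t) λ
        { (inj₂ reg-t) → noDoubleRoot ts distinct
          (isPolynomial-* pc (isPolynomial-+ isPolynomial-id (isPolynomial-const (- ι t)))) pq
          (regular-* reg (regular-0-t reg-t))
          (λ z → trans (*-assoc (c z) (z - ι t) _) (eq z))
        ; (inj₁ t≈0) → regular≉0
          (regular-* reg (rootProduct-regular (All.map (λ f → f t≈0) apart)))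
          (trans (cancel-z (isPolynomial-* pc (isPolynomial-rootProduct ts))
              (isPolynomial-* isPolynomial-id pq) (divided t≈0) 0#) (zeroˡ _))
        }
        where
        divided : ι t ≈ 0# → ∀ z → z * (c z * rootProduct ts z) ≈ z * (z * q z)
        divided t≈0 z = trans (trans
          (solve 3 (λ z c p → z :* (c :* p) := c :* (z :* p)) refl z (c z) (rootProduct ts z))
          (*-congˡ (*-congʳ (sym z-t≈z)))) (eq z)
          where
          z-t≈z : z - ι t ≈ z
          z-t≈z = trans (+-congˡ (trans (-‿cong t≈0) -0#≈0#)) (+-identityʳ z)

-- Kernel vectors of skew-symmetric matrices

-- Double negation passes through finite conjunctions, so undecidable case distinctions can be made
-- for all indices at once.
¬¬-∀Fin : ∀ {n} {P : Fin n → Set} → (∀ i → ¬ ¬ P i) → ¬ ¬ (∀ i → P i)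
¬¬-∀Fin {zero}  f k = k λ ()
¬¬-∀Fin {suc n} f k = f zero λ p → ¬¬-∀Fin (f ∘ suc) λ ps → k λ where
  zero    → p
  (suc i) → ps i

suc∣p-x∣≡∣p∣ : ∀ {n} {p : Subset n} {x} → x ∈ p → suc ∣ p Subset.- x ∣ ≡ ∣ p ∣
suc∣p-x∣≡∣p∣ {p = inside ∷ p}  {zero}  x∈p = ≡.cong (suc ∘ ∣_∣) (Subset.p─⊥≡p p)
suc∣p-x∣≡∣p∣ {p = outside ∷ p} {suc x} x∈p = suc∣p-x∣≡∣p∣ (Subset.drop-there x∈p)
suc∣p-x∣≡∣p∣ {p = inside ∷ p}  {suc x} x∈p = ≡.cong suc (suc∣p-x∣≡∣p∣ (Subset.drop-there x∈p))

x∈p─q⇒x∉q : ∀ {n} {p q : Subset n} {x} → x ∈ p Subset.─ q → x ∉ q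
x∈p─q⇒x∉q {p = _ ∷ _} {inside ∷ _} {zero} ()
x∈p─q⇒x∉q {p = _ ∷ _} {outside ∷ _} {zero} _ ()
x∈p─q⇒x∉q {p = _ ∷ _} {_ ∷ _} {suc x} x∈p─q x∈q =
  x∈p─q⇒x∉q (Subset.drop-there x∈p─q) (Subset.drop-there x∈q)

x∈p-y⇒x≢y : ∀ {n} {p : Subset n} {x y} → x ∈ p Subset.- y → x ≢ y
x∈p-y⇒x≢y {p = p} {x} x∈p-x ≡.refl = x∈p─q⇒x∉q {p = p} x∈p-x (Subset.x∈⁅x⁆ x)

∣p─q∣+∣q∣≡∣p∣ : ∀ {n} (p q : Subset n) → q Subset.⊆ p → ∣ p Subset.─ q ∣ ℕ.+ ∣ q ∣ ≡ ∣ p ∣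
∣p─q∣+∣q∣≡∣p∣ []            []            _   = ≡.refl
∣p─q∣+∣q∣≡∣p∣ (outside ∷ p) (outside ∷ q) q⊆p = ∣p─q∣+∣q∣≡∣p∣ p q (Subset.drop-∷-⊆ q⊆p)
∣p─q∣+∣q∣≡∣p∣ (inside ∷ p)  (outside ∷ q) q⊆p = ≡.cong suc (∣p─q∣+∣q∣≡∣p∣ p q (Subset.drop-∷-⊆ q⊆p))
∣p─q∣+∣q∣≡∣p∣ (inside ∷ p)  (inside ∷ q)  q⊆p =
  ≡.trans (ℕ.+-suc _ _) (≡.cong suc (∣p─q∣+∣q∣≡∣p∣ p q (Subset.drop-∷-⊆ q⊆p)))
∣p─q∣+∣q∣≡∣p∣ (outside ∷ p) (inside ∷ q)  q⊆p with () ← q⊆p Vec.here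

elements-∈ : ∀ {n} (S : Subset n) i → Vec.lookup (elements S) i ∈ S
elements-∈ (outside ∷ S) i = ≡.subst (_∈ outside ∷ S)
  (≡.sym (Vec.lookup-map i suc (elements S))) (Vec.there (elements-∈ S i))
elements-∈ (inside ∷ S) zero    = Vec.here
elements-∈ (inside ∷ S) (suc i) = ≡.subst (_∈ inside ∷ S)
  (≡.sym (Vec.lookup-map i suc (elements S))) (Vec.there (elements-∈ S i))

elements-index : ∀ {n} (S : Subset n) {x} → x ∈ S → ∃[ i ] Vec.lookup (elements S) i ≡ x
elements-index (outside ∷ S) {suc x} x∈S with i , eq ← elements-index S (Subset.drop-there x∈S) =
  i , ≡.trans (Vec.lookup-map i suc (elements S)) (≡.cong suc eq)
elements-index (inside ∷ S) {zero} _ = zero , ≡.refl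
elements-index (inside ∷ S) {suc x} x∈S with i , eq ← elements-index S (Subset.drop-there x∈S) =
  suc i , ≡.trans (Vec.lookup-map i suc (elements S)) (≡.cong suc eq)

∣p∣≡suc⇒Nonempty : ∀ {n m} (p : Subset n) → ∣ p ∣ ≡ suc m → Nonempty p
∣p∣≡suc⇒Nonempty (inside ∷ p)  _ = zero , Vec.here
∣p∣≡suc⇒Nonempty (outside ∷ p) eq with x , x∈p ← ∣p∣≡suc⇒Nonempty p eq = suc x , Vec.there x∈p

module SkewSymmetric (R : CommutativeRing 0ℓ 0ℓ) where
  open CommutativeRing R hiding (zero)
  open PolynomialFunctions R

  module Kernels
    (1≉0 : ¬ (1# ≈ 0#))
    (halve : ∀ x → x + x ≈ 0# → x ≈ 0#)
    (regular-or-zero : ∀ x → ¬ ¬ (x ≈ 0# ⊎ Regular x))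
    where
    open RingProperties ring using (-0#≈0#; -‿distribˡ-*; -‿distribʳ-*; -‿+-comm; -‿involutive)
    open SemiringSum semiring using (sum; sum-cong-≋; ∑-distrib-+; *-distribˡ-sum)
    open SetoidReasoning setoid
    open SemiringSolver commutativeSemiring using (solve; _:=_; _:*_; _:+_)
    open Determinant R using (sum-zero; sum-single; sum-neg; det-cong)
    open Determinant.Alternating R halve

    δ : ∀ {n} → Fin n → Fin n → Carrier
    δ i j = if does (i Fin.≟ j) then 1# else 0#

    δ-diagonal : ∀ {n} (i : Fin n) → δ i i ≈ 1#
    δ-diagonal i rewrite dec-true (i Fin.≟ i) ≡.refl = refl

    δ-off : ∀ {n} {i j : Fin n} → i ≢ j → δ i j ≈ 0#
    δ-off {i = i} {j} i≢j rewrite dec-false (i Fin.≟ j) i≢j = refl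

    sum-δ : ∀ {n} (f : Fin n → Carrier) k → sum (λ j → f j * δ k j) ≈ f k
    sum-δ f k = trans
      (sum-single _ k λ j j≢k → trans (*-congˡ (δ-off (j≢k ∘ ≡.sym))) (zeroʳ (f j)))
      (trans (*-congˡ (δ-diagonal k)) (*-identityʳ (f k)))

    sum-linear : ∀ {n} a b c (f g h : Fin n → Carrier) →
      sum (λ j → a * f j + (b * g j + c * h j)) ≈ a * sum f + (b * sum g + c * sum h)
    sum-linear a b c f g h = trans (∑-distrib-+ (λ j → a * f j) (λ j → b * g j + c * h j))
      (+-cong (sym (*-distribˡ-sum a f)) (trans (∑-distrib-+ (λ j → b * g j) (λ j → c * h j))
        (+-cong (sym (*-distribˡ-sum b g)) (sym (*-distribˡ-sum c h)))))

    -- A kernel vector of the principal submatrix on `C`, extended by zero to all coordinates, so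
    -- that elimination shrinks `C` without renumbering. The regular coordinate witnesses that it is
    -- nonzero.
    record KernelVector {n} (M : Matrix Carrier n) (C : Subset n) : Set where
      field
        vector  : Fin n → Carrier
        support : ∀ {i} → i ∉ C → vector i ≈ 0#
        index   : Fin n
        index∈  : index ∈ C
        regular : Regular (vector index)
        kills   : ∀ {i} → i ∈ C → (M · vector) i ≈ 0#

    Skew : ∀ {n} → Matrix Carrier n → Set
    Skew M = ∀ i j → M j i ≈ - M i j

    module Pivot {n} (M : Matrix Carrier n) (skew : Skew M) (p q : Fin n) where

      diagonal : ∀ i → M i i ≈ 0#
      diagonal i = halve _ (trans (+-congˡ (skew i i)) (-‿inverseʳ (M i i)))

      a : Carrier
      a = M p q

      -- a times the Schur complement of the block of M on rows and columns p, q.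
      reduced : Matrix Carrier n
      reduced i j = a * M i j + (M i p * M q j + (- M i q) * M p j)

      reduced-skew : Skew reduced
      reduced-skew i j = begin
        a * M j i + (M j p * M q i + (- M j q) * M p i)
          ≈⟨ +-cong (*-congˡ (skew i j)) (+-cong (*-cong (skew p j) (skew i q))
               (*-cong (trans (-‿cong (skew q j)) (-‿involutive (M q j))) (skew i p))) ⟩
        a * - M i j + (- M p j * - M i q + M q j * - M i p)
          ≈⟨ +-cong (sym (-‿distribʳ-* a (M i j))) (+-cong
               (trans (sym (-‿distribˡ-* (M p j) (- M i q))) (-‿cong (*-comm (M p j) (- M i q))))
               (trans (sym (-‿distribʳ-* (M q j) (M i p))) (-‿cong (*-comm (M q j) (M i p))))) ⟩
        - (a * M i j) + (- (- M i q * M p j) + - (M i p * M q j))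
          ≈⟨ +-congˡ (trans (+-comm _ _) (-‿+-comm _ _)) ⟩
        - (a * M i j) + - (M i p * M q j + - M i q * M p j)
          ≈⟨ -‿+-comm _ _ ⟩
        - (a * M i j + (M i p * M q j + - M i q * M p j)) ∎

      reduced-row-p : ∀ j → reduced p j ≈ 0#
      reduced-row-p j = begin
        a * M p j + (M p p * M q j + (- a) * M p j)
          ≈⟨ +-congˡ (+-cong (trans (*-congʳ (diagonal p)) (zeroˡ _)) (sym (-‿distribˡ-* a (M p j)))) ⟩
        a * M p j + (0# - a * M p j)
          ≈⟨ +-congˡ (+-identityˡ _) ⟩
        a * M p j - a * M p j
          ≈⟨ -‿inverseʳ _ ⟩
        0# ∎

      reduced-row-q : ∀ j → reduced q j ≈ 0#
      reduced-row-q j = begin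
        a * M q j + (M q p * M q j + (- M q q) * M p j)
          ≈⟨ +-congˡ (+-cong (trans (*-congʳ (skew p q)) (sym (-‿distribˡ-* a (M q j))))
               (trans (*-congʳ (trans (-‿cong (diagonal q)) -0#≈0#)) (zeroˡ _))) ⟩
        a * M q j + (- (a * M q j) + 0#)
          ≈⟨ +-congˡ (+-identityʳ _) ⟩
        a * M q j - a * M q j
          ≈⟨ -‿inverseʳ _ ⟩
        0# ∎

      -- The corrections at `p` and `q` make rows `p` and `q` of `M · lifted y` vanish: since
      -- `M p q` is `a` and `M q p` is `- a`, they cancel `a * (M · y) p` and `a * (M · y) q`.
      -- Scaling `y` by `a` replaces division by the pivot.
      lifted : (Fin n → Carrier) → Fin n → Carrier
      lifted y j = a * y j + ((M · y) q * δ p j + (- (M · y) p) * δ q j)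

      lifted-off : ∀ y {j} → j ≢ p → j ≢ q → lifted y j ≈ a * y j
      lifted-off y j≢p j≢q = trans (+-congˡ (trans
        (+-cong (trans (*-congˡ (δ-off (j≢p ∘ ≡.sym))) (zeroʳ _)) (trans (*-congˡ (δ-off (j≢q ∘ ≡.sym))) (zeroʳ _)))
        (+-identityˡ 0#))) (+-identityʳ _)

      reduced-· : ∀ y i → (M · lifted y) i ≈ (reduced · y) i
      reduced-· y i = begin
        sum (λ j → M i j * lifted y j)
          ≈⟨ sum-cong-≋ (λ j → solve 7 (λ m a y b d c e →
               m :* (a :* y :+ (b :* d :+ c :* e)) := a :* (m :* y) :+ (b :* (m :* d) :+ c :* (m :* e)))
               refl (M i j) a (y j) ((M · y) q) (δ p j) (- (M · y) p) (δ q j)) ⟩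
        sum (λ j → a * (M i j * y j) + ((M · y) q * (M i j * δ p j) + (- (M · y) p) * (M i j * δ q j)))
          ≈⟨ sum-linear a ((M · y) q) (- (M · y) p)
               (λ j → M i j * y j) (λ j → M i j * δ p j) (λ j → M i j * δ q j) ⟩
        a * (M · y) i + ((M · y) q * sum (λ j → M i j * δ p j) + (- (M · y) p) * sum (λ j → M i j * δ q j))
          ≈⟨ +-congˡ (+-cong (trans (*-congˡ (sum-δ (M i) p)) (*-comm _ _))
               (trans (*-congˡ (sum-δ (M i) q)) (trans (sym (-‿distribˡ-* _ _))
                 (trans (-‿cong (*-comm _ _)) (-‿distribˡ-* _ _))))) ⟩
        a * (M · y) i + (M i p * (M · y) q + (- M i q) * (M · y) p)
          ≈⟨ sym (sum-linear a (M i p) (- M i q)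
               (λ j → M i j * y j) (λ j → M q j * y j) (λ j → M p j * y j)) ⟩
        sum (λ j → a * (M i j * y j) + (M i p * (M q j * y j) + (- M i q) * (M p j * y j)))
          ≈⟨ sum-cong-≋ (λ j → solve 7 (λ a m y b d c e →
               a :* (m :* y) :+ (b :* (d :* y) :+ c :* (e :* y)) := (a :* m :+ (b :* d :+ c :* e)) :* y)
               refl a (M i j) (y j) (M i p) (M q j) (- M i q) (M p j)) ⟩
        sum (λ j → reduced i j * y j) ∎

      row-zero : ∀ {i} (y : Fin n → Carrier) → (∀ j → reduced i j ≈ 0#) → (reduced · y) i ≈ 0#
      row-zero y row≈0 = sum-zero _ λ j → trans (*-congʳ (row≈0 j)) (zeroˡ (y j))

      lift : ∀ {C} → p ∈ C → q ∈ C → Regular a →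
        KernelVector reduced (C Subset.- p Subset.- q) → KernelVector M C
      lift {C} p∈C q∈C reg-a κ = record
        { vector  = lifted κ.vector
        ; support = λ i∉C → trans
            (lifted-off κ.vector (λ { ≡.refl → i∉C p∈C }) (λ { ≡.refl → i∉C q∈C }))
            (trans (*-congˡ (κ.support (i∉C ∘ C′⊆C))) (zeroʳ a))
        ; index   = κ.index
        ; index∈  = C′⊆C κ.index∈
        ; regular = regular-resp (sym (lifted-off κ.vector index≢p (x∈p-y⇒x≢y κ.index∈)))
            (regular-* reg-a κ.regular)
        ; kills   = λ {i} i∈C → trans (reduced-· κ.vector i) (reduced-kills i∈C)
        }
        where
        module κ = KernelVector κ
        C′⊆C : C Subset.- p Subset.- q Subset.⊆ C
        C′⊆C = Subset.p─q⊆p C Subset.⁅ p ⁆ ∘ Subset.p─q⊆p (C Subset.- p) Subset.⁅ q ⁆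
        index≢p : κ.index ≢ p
        index≢p = x∈p-y⇒x≢y (Subset.p─q⊆p (C Subset.- p) Subset.⁅ q ⁆ κ.index∈)
        reduced-kills : ∀ {i} → i ∈ C → (reduced · κ.vector) i ≈ 0#
        reduced-kills {i} i∈C with i Fin.≟ p | i Fin.≟ q
        ... | yes ≡.refl | _          = row-zero κ.vector reduced-row-p
        ... | no _       | yes ≡.refl = row-zero κ.vector reduced-row-q
        ... | no i≢p     | no i≢q     =
          κ.kills (Subset.x∈p∧x≢y⇒x∈p-y (Subset.x∈p∧x≢y⇒x∈p-y i∈C i≢p) i≢q)

    -- Induction on half the size. If row `p` has a regular entry on `C`, it serves as a pivot, and
    -- removing `p` and `q` keeps the size odd. Otherwise row `p` is zero on `C`, by skew-symmetry
    -- so is column `p`, and the unit vector at `p` is annihilated.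
    kernelVector : ∀ {n} m (M : Matrix Carrier n) (C : Subset n) → ∣ C ∣ ≡ suc (m ℕ.* 2) →
      Skew M → ¬ ¬ KernelVector M C
    kernelVector m M C ∣C∣≡ skew none with p , p∈C ← ∣p∣≡suc⇒Nonempty C ∣C∣≡ =
      ¬¬-excluded-middle {A = ∃[ q ] q ∈ C × Regular (M p q)} λ
      { (yes (q , q∈C , reg-a)) → eliminate m ∣C∣≡ q q∈C reg-a
      ; (no ¬pivot) → ¬¬-∀Fin {P = λ j → j ∈ C → M p j ≈ 0#} (λ j k → regular-or-zero (M p j) λ
          { (inj₁ z)   → k λ _ → z
          ; (inj₂ reg) → k λ j∈C → ⊥-elim (¬pivot (j , j∈C , reg))
          }) λ row≈0 → none record
            { vector  = δ p
            ; support = λ {i} i∉C → δ-off {i = p} {i} λ { ≡.refl → i∉C p∈C }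
            ; index   = p
            ; index∈  = p∈C
            ; regular = λ w eq → trans (sym (*-identityˡ w)) (trans (*-congʳ (sym (δ-diagonal p))) eq)
            ; kills   = λ {i} i∈C → trans (sum-δ (M i) p)
                (trans (skew p i) (trans (-‿cong (row≈0 i i∈C)) -0#≈0#))
            }
      }
      where
      eliminate : ∀ m → ∣ C ∣ ≡ suc (m ℕ.* 2) → ∀ q → q ∈ C → Regular (M p q) → ⊥
      eliminate m ∣C∣≡ q q∈C reg-a = recurse m (≡.trans (suc∣p-x∣≡∣p∣ q∈C-p)
        (ℕ.suc-injective (≡.trans (suc∣p-x∣≡∣p∣ p∈C) ∣C∣≡)))
        where
        open Pivot M skew p q
        q≢p : q ≢ p
        q≢p ≡.refl = 1≉0 (reg-a 1# (trans (*-congʳ (diagonal p)) (zeroˡ 1#)))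
        q∈C-p : q ∈ C Subset.- p
        q∈C-p = Subset.x∈p∧x≢y⇒x∈p-y q∈C q≢p
        recurse : ∀ m → suc ∣ C Subset.- p Subset.- q ∣ ≡ m ℕ.* 2 → ⊥
        -- The case `m = 0` is absurd: a block of one element has no room for both `p` and `q`.
        recurse (suc m) eq = kernelVector m reduced (C Subset.- p Subset.- q)
          (ℕ.suc-injective eq) reduced-skew (none ∘ lift p∈C q∈C reg-a)

    module CharacteristicMatrix {n} (B : Matrix Carrier n) where

      charMatrix : Carrier → Matrix Carrier n
      charMatrix z i j = z * δ i j + - B i j

      isPolynomial-charMatrix : ∀ i j → IsPolynomial (λ z → charMatrix z i j)
      isPolynomial-charMatrix i j = isPolynomial-+
        (isPolynomial-* isPolynomial-id (isPolynomial-const (δ i j))) (isPolynomial-const (- B i j))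

      charMatrix-· : ∀ {x} → (∀ i → (B · x) i ≈ 0#) → ∀ z i → (charMatrix z · x) i ≈ z * x i
      charMatrix-· {x} Bx≈0 z i = begin
        sum (λ j → (z * δ i j + - B i j) * x j)
          ≈⟨ sum-cong-≋ (λ j → trans (distribʳ (x j) _ _) (+-cong
               (solve 3 (λ z d x → z :* d :* x := z :* (x :* d)) refl z (δ i j) (x j))
               (sym (-‿distribˡ-* (B i j) (x j))))) ⟩
        sum (λ j → z * (x j * δ i j) + - (B i j * x j))
          ≈⟨ ∑-distrib-+ (λ j → z * (x j * δ i j)) (λ j → - (B i j * x j)) ⟩
        sum (λ j → z * (x j * δ i j)) + sum (λ j → - (B i j * x j))
          ≈⟨ +-cong (sym (*-distribˡ-sum z (λ j → x j * δ i j))) (sum-neg (λ j → B i j * x j)) ⟩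
        z * sum (λ j → x j * δ i j) - (B · x) i
          ≈⟨ +-cong (*-congˡ (sum-δ x i)) (trans (-‿cong (Bx≈0 i)) -0#≈0#) ⟩
        z * x i + 0#
          ≈⟨ +-identityʳ _ ⟩
        z * x i ∎

      isPolynomial-[≔] : ∀ {M : Carrier → Matrix Carrier n} → (∀ i j → IsPolynomial (λ z → M z i j)) →
        ∀ k v i j → IsPolynomial (λ z → (M z [ k ≔ v ]) i j)
      isPolynomial-[≔] {M} pM k v i j with j Fin.≟ k
      ... | yes ≡.refl = isPolynomial-resp (λ z → sym (replaced-at (M z) j v i)) (isPolynomial-const (v i))
      ... | no j≢k = isPolynomial-resp (λ z → sym (replaced-off (M z) k v i j j≢k)) (pM i j)

      module _ {x y : Fin n → Carrier} (Bx≈0 : ∀ i → (B · x) i ≈ 0#) (By≈0 : ∀ i → (B · y) i ≈ 0#)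
               {i : Fin n} (yi≈0 : y i ≈ 0#) (k : Fin n) where

        quotient : Carrier → Carrier
        quotient z = det rawRing (charMatrix z [ i ≔ x ] [ k ≔ y ])

        isPolynomial-quotient : IsPolynomial quotient
        isPolynomial-quotient = isPolynomial-det (λ z → charMatrix z [ i ≔ x ] [ k ≔ y ])
          (isPolynomial-[≔] {M = λ z → charMatrix z [ i ≔ x ]}
            (isPolynomial-[≔] {M = charMatrix} isPolynomial-charMatrix i x) k y)

        -- Cramer's rule for `x` at `i` extracts one `z` and puts `x` into column `i`. As
        -- `y i ≈ 0#`, that column does not affect the product with `y`, so the new matrix still
        -- maps `y` to `z` times `y`, and Cramer's rule for `y` at `k` extracts the second `z`.
        z²∣det : ∀ z → (y k * x i) * det rawRing (charMatrix z) ≈ z * (z * quotient z)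
        z²∣det z = begin
          (y k * x i) * det rawRing (charMatrix z)
            ≈⟨ *-assoc _ _ _ ⟩
          y k * (x i * det rawRing (charMatrix z))
            ≈⟨ *-congˡ (extract (charMatrix z) x i (charMatrix-· Bx≈0 z)) ⟩
          y k * (z * det rawRing N)
            ≈⟨ solve 3 (λ y z d → y :* (z :* d) := z :* (y :* d)) refl (y k) z _ ⟩
          z * (y k * det rawRing N)
            ≈⟨ *-congˡ (extract N y k N·y≈zy) ⟩
          z * (z * quotient z) ∎
          where
          N = charMatrix z [ i ≔ x ]
          extract : ∀ M u j → (∀ r → (M · u) r ≈ z * u r) →
            u j * det rawRing M ≈ z * det rawRing (M [ j ≔ u ])
          extract M u j Mu≈zu = trans (cramer M u j)
            (trans (replaced-cong M j Mu≈zu) (det-column-* M j z u))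
          N·y≈zy : ∀ r → (N · y) r ≈ z * y r
          N·y≈zy r = trans (sum-cong-≋ entry) (charMatrix-· By≈0 z r)
            where
            entry : ∀ j → N r j * y j ≈ charMatrix z r j * y j
            entry j with j Fin.≟ i
            ... | yes ≡.refl = trans (*-congˡ yi≈0) (trans (zeroʳ _) (sym (trans (*-congˡ yi≈0) (zeroʳ _))))
            ... | no j≢i = *-congʳ (replaced-off (charMatrix z) i x r j j≢i)

    sum-elements : ∀ {n} (f : Fin n → Carrier) (S : Subset n) → (∀ {i} → i ∉ S → f i ≈ 0#) →
      sum (λ i → f (Vec.lookup (elements S) i)) ≈ sum f
    sum-elements f []            f≈0 = refl
    sum-elements f (outside ∷ S) f≈0 = begin
      sum (λ i → f (Vec.lookup (Vec.map suc (elements S)) i))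
        ≈⟨ sum-cong-≋ (λ i → reflexive (≡.cong f (Vec.lookup-map i suc (elements S)))) ⟩
      sum (λ i → f (suc (Vec.lookup (elements S) i)))
        ≈⟨ sum-elements (f ∘ suc) S (λ i∉S → f≈0 (i∉S ∘ Subset.drop-there)) ⟩
      sum (f ∘ suc)
        ≈⟨ sym (+-identityˡ _) ⟩
      0# + sum (f ∘ suc)
        ≈⟨ +-congʳ (sym (f≈0 {zero} λ ())) ⟩
      f zero + sum (f ∘ suc) ∎
    sum-elements f (inside ∷ S) f≈0 = +-congˡ (begin
      sum (λ i → f (Vec.lookup (Vec.map suc (elements S)) i))
        ≈⟨ sum-cong-≋ (λ i → reflexive (≡.cong f (Vec.lookup-map i suc (elements S)))) ⟩
      sum (λ i → f (suc (Vec.lookup (elements S) i)))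
        ≈⟨ sum-elements (f ∘ suc) S (λ i∉S → f≈0 (i∉S ∘ Subset.drop-there)) ⟩
      sum (f ∘ suc) ∎)

    -- What the argument needs of the numbering of a principal submatrix; `reindex` turns its row
    -- sums into sums over all indices of the full matrix.
    record Enumeration {m n} (e : Fin m → Fin n) (S : Subset n) : Set where
      field
        member  : ∀ i → e i ∈ S
        index   : ∀ {x} → x ∈ S → ∃[ i ] e i ≡ x
        reindex : ∀ (f : Fin n → Carrier) → (∀ {i} → i ∉ S → f i ≈ 0#) → sum (f ∘ e) ≈ sum f

    elementsEnumeration : ∀ {n} (S : Subset n) → Enumeration (Vec.lookup (elements S)) S
    elementsEnumeration S = record
      { member  = elements-∈ S
      ; index   = elements-index S
      ; reindex = λ f f≈0 → sum-elements f S f≈0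
      }

    -- What linear algebra retains of an odd component `C` of the graph on `S`: `isolated` expresses
    -- that no edge joins `C` to the rest of `S`, and `half` drives the induction of `kernelVector`.
    record IsOddBlock {n} (B : Matrix Carrier n) (S C : Subset n) : Set where
      field
        {half}   : ℕ
        C⊆S      : C Subset.⊆ S
        odd      : ∣ C ∣ ≡ suc (half ℕ.* 2)
        isolated : ∀ {i j} → i ∈ S → i ∉ C → j ∈ C → B i j ≈ 0#

    -- Rows in `C` vanish by `kills`. In the other rows the columns in `C` contribute nothing by
    -- isolation, and those outside `C` nothing by the support.
    restriction-kills : ∀ {m n} {B : Matrix Carrier n} {B′ : Matrix Carrier m} {e S C} →
      Enumeration e S → (∀ i j → B′ i j ≈ B (e i) (e j)) → IsOddBlock B S C →
      (κ : KernelVector B C) → ∀ i → (B′ · (KernelVector.vector κ ∘ e)) i ≈ 0#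
    restriction-kills {B = B} {B′} {e} {S} {C} enumeration B′≈ block κ i = begin
      sum (λ j → B′ i j * κ.vector (e j))
        ≈⟨ sum-cong-≋ (λ j → *-congʳ (B′≈ i j)) ⟩
      sum (λ j → B (e i) (e j) * κ.vector (e j))
        ≈⟨ reindex (λ j → B (e i) j * κ.vector j)
             (λ j∉S → trans (*-congˡ (κ.support (j∉S ∘ C⊆S))) (zeroʳ _)) ⟩
      (B · κ.vector) (e i)
        ≈⟨ row ⟩
      0# ∎
      where
      open Enumeration enumeration
      open IsOddBlock block
      module κ = KernelVector κ
      row : (B · κ.vector) (e i) ≈ 0#
      row with e i Subset.∈? C
      ... | yes ei∈C = κ.kills ei∈C
      ... | no ei∉C  = sum-zero (λ j → B (e i) j * κ.vector j) entry
        where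
        entry : ∀ j → B (e i) j * κ.vector j ≈ 0#
        entry j with j Subset.∈? C
        ... | yes j∈C = trans (*-congʳ (isolated (member i) ei∉C j∈C)) (zeroˡ _)
        ... | no j∉C  = trans (*-congˡ (κ.support j∉C)) (zeroʳ _)

    module _
      (point : ℕ → Carrier)
      (point-regular : ∀ k → Regular (point k))
      (points-apart : ∀ {j k} → j ℕ.< k → Regular (point k - point j))
      {T : Set} (ι : T → Carrier)
      where
      open Roots point point-regular points-apart
      open CharacteristicMatrix

      -- N and φ are compared with the expected expressions only up to ≈ : over ℂ the two are
      -- definitionally equal, but checking that would unfold the Cauchy proofs.
      oddBlocks-intersect : ∀ {m n} {B : Matrix Carrier n} {B′ : Matrix Carrier m} {e S C C′} →
        Enumeration e S → (∀ i j → B′ i j ≈ B (e i) (e j)) → Skew B →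
        IsOddBlock B S C → IsOddBlock B S C′ → (∀ {i} → i ∈ C → i ∉ C′) →
        ∀ {l} {ts : Vec T l} → AllPairs (λ s t → ι s ≈ 0# → Regular (ι t)) ts →
        {N : Carrier → Matrix Carrier m} → (∀ z i j → N z i j ≈ z * δ i j + - B′ i j) →
        {φ : Carrier → T → Carrier → Carrier} → (∀ z t p → φ z t p ≈ (z - ι t) * p) →
        ¬ (∀ z → det rawRing (N z) ≈ Vec.foldr′ (φ z) 1# ts)
      oddBlocks-intersect {m} {B = B} {B′} {e} {S} {C} {C′} enumeration B′≈ skew block block′ disjoint
        {ts = ts} distinct N≈ {φ = φ} φ≈ spectrum =
        kernelVector (IsOddBlock.half block) B C (IsOddBlock.odd block) skew λ κ →
        kernelVector (IsOddBlock.half block′) B C′ (IsOddBlock.odd block′) skew λ κ′ →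
        contradict κ κ′
        where
        open Enumeration enumeration
        foldr-φ : ∀ z {l} (ts : Vec T l) →
          Vec.foldr′ (φ z) 1# ts ≈ rootProduct regular-or-zero 1≉0 ι ts z
        foldr-φ z []       = refl
        foldr-φ z (t ∷ ts) = trans (φ≈ z t _) (*-congˡ (foldr-φ z ts))
        contradict : KernelVector B C → KernelVector B C′ → ⊥
        contradict κ κ′
          with i , ei≡ ← index (IsOddBlock.C⊆S block (KernelVector.index∈ κ))
             | k , ek≡ ← index (IsOddBlock.C⊆S block′ (KernelVector.index∈ κ′)) =
          noDoubleRoot regular-or-zero 1≉0 ι ts distinct
            (isPolynomial-const (y k * x i))
            (isPolynomial-quotient B′ {x} {y} Bx≈0 By≈0 yi≈0 k)
            (regular-*
              (≡.subst (Regular ∘ κ′.vector) (≡.sym ek≡) κ′.regular)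
              (≡.subst (Regular ∘ κ.vector) (≡.sym ei≡) κ.regular))
            (λ z → trans
              (*-congˡ (trans (sym (foldr-φ z ts)) (trans (sym (spectrum z)) (det-cong (N≈ z)))))
              (z²∣det B′ {x} {y} Bx≈0 By≈0 yi≈0 k z))
          where
          module κ = KernelVector κ
          module κ′ = KernelVector κ′
          x y : Fin m → Carrier
          x = κ.vector ∘ e
          y = κ′.vector ∘ e
          Bx≈0 = restriction-kills {B′ = B′} enumeration B′≈ block κ
          By≈0 = restriction-kills {B′ = B′} enumeration B′≈ block′ κ′
          -- Disjointness enters here: `e i` lies in `C`, hence outside `C′`, where `κ′` is zero.
          yi≈0 : y i ≈ 0#
          yi≈0 = κ′.support λ ei∈C′ → disjoint κ.index∈ (≡.subst (_∈ C′) ei≡ ei∈C′)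

-- Complex numbers

open ≡ using (refl; sym; trans; cong; cong₂; subst)

-- `_≃_` speaks only of the sequences, so the Cauchy proofs of its arguments cannot be inferred; for
-- this reason the reals are passed explicitly here and below.
pointwise : ∀ x y → (∀ n → seq x n ≡ seq y n) → x ≃ y
pointwise x y x≡y ε 0<ε = 0 , λ n _ → subst (λ d → ℚ.∣ d ∣ ℚ.< ε)
  (sym (trans (cong (ℚ._- seq y n) (x≡y n)) (ℚ.+-inverseʳ (seq y n)))) 0<ε

≃-sym : ∀ x y → x ≃ y → y ≃ x
≃-sym x y x≃y ε 0<ε with x≃y ε 0<ε
... | N , close = N , λ n n≥N → subst (ℚ._< ε)
  (trans (sym (ℚ.∣-p∣≡∣p∣ (seq x n ℚ.- seq y n))) (cong ℚ.∣_∣ (flip (seq x n) (seq y n))))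
  (close n n≥N)
  where
  open +-*-Solver
  flip : ∀ a b → ℚ.- (a ℚ.- b) ≡ b ℚ.- a
  flip = solve 2 (λ a b → :- (a :- b) := b :- a) refl

≃-trans : ∀ x y z → x ≃ y → y ≃ z → x ≃ z
≃-trans x y z x≃y y≃z ε 0<ε
  with x≃y (½ ℚ.* ε) (half-pos {ε} 0<ε) | y≃z (½ ℚ.* ε) (half-pos {ε} 0<ε)
... | M , xy | N , yz = M ℕ.⊔ N , λ n n≥ → subst (λ d → ℚ.∣ d ∣ ℚ.< ε)
  (telescope (seq x n) (seq y n) (seq z n))
  (sum-close {ε} (seq x n ℚ.- seq y n) (seq y n ℚ.- seq z n)
    (xy n (ℕ.m⊔n≤o⇒m≤o M N n≥)) (yz n (ℕ.m⊔n≤o⇒n≤o M N n≥)))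
  where
  open +-*-Solver
  telescope : ∀ a b c → (a ℚ.- b) ℚ.+ (b ℚ.- c) ≡ a ℚ.- c
  telescope = solve 3 (λ a b c → (a :- b) :+ (b :- c) := a :- c) refl

+ℝ-cong : ∀ x y u v → x ≃ y → u ≃ v → x +ℝ u ≃ y +ℝ v
+ℝ-cong x y u v x≃y u≃v ε 0<ε
  with x≃y (½ ℚ.* ε) (half-pos {ε} 0<ε) | u≃v (½ ℚ.* ε) (half-pos {ε} 0<ε)
... | M , xy | N , uv = M ℕ.⊔ N , λ n n≥ → subst (λ d → ℚ.∣ d ∣ ℚ.< ε)
  (regroup (seq x n) (seq y n) (seq u n) (seq v n))
  (sum-close {ε} (seq x n ℚ.- seq y n) (seq u n ℚ.- seq v n)
    (xy n (ℕ.m⊔n≤o⇒m≤o M N n≥)) (uv n (ℕ.m⊔n≤o⇒n≤o M N n≥)))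
  where
  open +-*-Solver
  regroup : ∀ a b c d → (a ℚ.- b) ℚ.+ (c ℚ.- d) ≡ (a ℚ.+ c) ℚ.- (b ℚ.+ d)
  regroup = solve 4 (λ a b c d → (a :- b) :+ (c :- d) := (a :+ c) :- (b :+ d)) refl

-ℝ-cong : ∀ x y → x ≃ y → -ℝ x ≃ -ℝ y
-ℝ-cong x y x≃y ε 0<ε =
  let N , close = ≃-sym x y x≃y ε 0<ε in N , λ n n≥N → subst (λ d → ℚ.∣ d ∣ ℚ.< ε) (flip (seq x n) (seq y n)) (close n n≥N)
  where
  open +-*-Solver
  flip : ∀ a b → b ℚ.- a ≡ (ℚ.- a) ℚ.- (ℚ.- b)
  flip = solve 2 (λ a b → b :- a := (:- a) :- (:- b)) refl

-- Bounds for `x` and `v` suffice, as x u - y v = x (u - v) + v (x - y).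
*ℝ-cong : ∀ x y u v → x ≃ y → u ≃ v → x *ℝ u ≃ y *ℝ v
*ℝ-cong x y u v x≃y u≃v ε 0<ε =
  let B , B>0 , K , x≤B = bounded (seq x) (cauchy x)
      C , C>0 , L , v≤C = bounded (seq v) (cauchy v)
      M , xy = x≃y (scaled C C>0 (½ ℚ.* ε)) (scaled-pos C C>0 {½ ℚ.* ε} (half-pos {ε} 0<ε))
      N , uv = u≃v (scaled B B>0 (½ ℚ.* ε)) (scaled-pos B B>0 {½ ℚ.* ε} (half-pos {ε} 0<ε))
  in (K ℕ.⊔ L) ℕ.⊔ (M ℕ.⊔ N) , λ n n≥ →
  let n≥KL = ℕ.m⊔n≤o⇒m≤o (K ℕ.⊔ L) (M ℕ.⊔ N) n≥
      n≥MN = ℕ.m⊔n≤o⇒n≤o (K ℕ.⊔ L) (M ℕ.⊔ N) n≥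
  in product-close {B} {C} {ε} {seq x n} {seq y n} {seq u n} {seq v n} B>0 C>0
       (x≤B n (ℕ.m⊔n≤o⇒m≤o K L n≥KL)) (uv n (ℕ.m⊔n≤o⇒n≤o M N n≥MN))
       (v≤C n (ℕ.m⊔n≤o⇒n≤o K L n≥KL)) (xy n (ℕ.m⊔n≤o⇒m≤o M N n≥MN))

pointwiseℂ : ∀ z w → (∀ n → seq (re z) n ≡ seq (re w) n) → (∀ n → seq (im z) n ≡ seq (im w) n) →
  re z ≃ re w × im z ≃ im w
pointwiseℂ z w re≡ im≡ = pointwise (re z) (re w) re≡ , pointwise (im z) (im w) im≡

module ℂ-identities where
  open +-*-Solver

  assoc-re : ∀ a b c d e f →
    (a ℚ.* c ℚ.- b ℚ.* d) ℚ.* e ℚ.- (a ℚ.* d ℚ.+ b ℚ.* c) ℚ.* f ≡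
    a ℚ.* (c ℚ.* e ℚ.- d ℚ.* f) ℚ.- b ℚ.* (c ℚ.* f ℚ.+ d ℚ.* e)
  assoc-re = solve 6 (λ a b c d e f →
    (a :* c :- b :* d) :* e :- (a :* d :+ b :* c) :* f :=
    a :* (c :* e :- d :* f) :- b :* (c :* f :+ d :* e)) refl

  assoc-im : ∀ a b c d e f →
    (a ℚ.* c ℚ.- b ℚ.* d) ℚ.* f ℚ.+ (a ℚ.* d ℚ.+ b ℚ.* c) ℚ.* e ≡
    a ℚ.* (c ℚ.* f ℚ.+ d ℚ.* e) ℚ.+ b ℚ.* (c ℚ.* e ℚ.- d ℚ.* f)
  assoc-im = solve 6 (λ a b c d e f →
    (a :* c :- b :* d) :* f :+ (a :* d :+ b :* c) :* e :=
    a :* (c :* f :+ d :* e) :+ b :* (c :* e :- d :* f)) refl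

  identityˡ-re : ∀ a b →
    1ℚ ℚ.* a ℚ.- 0ℚ ℚ.* b ≡ a
  identityˡ-re = solve 2 (λ a b →
    con 1ℚ :* a :- con 0ℚ :* b := a) refl

  identityˡ-im : ∀ a b →
    1ℚ ℚ.* b ℚ.+ 0ℚ ℚ.* a ≡ b
  identityˡ-im = solve 2 (λ a b →
    con 1ℚ :* b :+ con 0ℚ :* a := b) refl

  identityʳ-re : ∀ a b →
    a ℚ.* 1ℚ ℚ.- b ℚ.* 0ℚ ≡ a
  identityʳ-re = solve 2 (λ a b →
    a :* con 1ℚ :- b :* con 0ℚ := a) refl

  identityʳ-im : ∀ a b →
    a ℚ.* 0ℚ ℚ.+ b ℚ.* 1ℚ ≡ b
  identityʳ-im = solve 2 (λ a b →
    a :* con 0ℚ :+ b :* con 1ℚ := b) refl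

  distribˡ-re : ∀ a b c d e f →
    a ℚ.* (c ℚ.+ e) ℚ.- b ℚ.* (d ℚ.+ f) ≡ (a ℚ.* c ℚ.- b ℚ.* d) ℚ.+ (a ℚ.* e ℚ.- b ℚ.* f)
  distribˡ-re = solve 6 (λ a b c d e f →
    a :* (c :+ e) :- b :* (d :+ f) := (a :* c :- b :* d) :+ (a :* e :- b :* f)) refl

  distribˡ-im : ∀ a b c d e f →
    a ℚ.* (d ℚ.+ f) ℚ.+ b ℚ.* (c ℚ.+ e) ≡ (a ℚ.* d ℚ.+ b ℚ.* c) ℚ.+ (a ℚ.* f ℚ.+ b ℚ.* e)
  distribˡ-im = solve 6 (λ a b c d e f →
    a :* (d :+ f) :+ b :* (c :+ e) := (a :* d :+ b :* c) :+ (a :* f :+ b :* e)) refl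

  distribʳ-re : ∀ a b c d e f →
    (c ℚ.+ e) ℚ.* a ℚ.- (d ℚ.+ f) ℚ.* b ≡ (c ℚ.* a ℚ.- d ℚ.* b) ℚ.+ (e ℚ.* a ℚ.- f ℚ.* b)
  distribʳ-re = solve 6 (λ a b c d e f →
    (c :+ e) :* a :- (d :+ f) :* b := (c :* a :- d :* b) :+ (e :* a :- f :* b)) refl

  distribʳ-im : ∀ a b c d e f →
    (c ℚ.+ e) ℚ.* b ℚ.+ (d ℚ.+ f) ℚ.* a ≡ (c ℚ.* b ℚ.+ d ℚ.* a) ℚ.+ (e ℚ.* b ℚ.+ f ℚ.* a)
  distribʳ-im = solve 6 (λ a b c d e f →
    (c :+ e) :* b :+ (d :+ f) :* a := (c :* b :+ d :* a) :+ (e :* b :+ f :* a)) refl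

  comm-re : ∀ a b c d →
    a ℚ.* c ℚ.- b ℚ.* d ≡ c ℚ.* a ℚ.- d ℚ.* b
  comm-re = solve 4 (λ a b c d →
    a :* c :- b :* d := c :* a :- d :* b) refl

  comm-im : ∀ a b c d →
    a ℚ.* d ℚ.+ b ℚ.* c ≡ c ℚ.* b ℚ.+ d ℚ.* a
  comm-im = solve 4 (λ a b c d →
    a :* d :+ b :* c := c :* b :+ d :* a) refl

ℂ-commutativeRing : CommutativeRing 0ℓ 0ℓ
ℂ-commutativeRing = record
  { Carrier = ℂ
  ; _≈_ = _≈_
  ; _+_ = _+_
  ; _*_ = _*_
  ; -_  = -_
  ; 0#  = 0#
  ; 1#  = 1#
  ; isCommutativeRing = record
    { isRing = record
      { +-isAbelianGroup = record
        { isGroup = record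
          { isMonoid = record
            { isSemigroup = record
              { isMagma = record
                { isEquivalence = record
                  { refl  = λ {z} → pointwiseℂ z z (λ _ → refl) (λ _ → refl)
                  ; sym   = λ {z} {w} (p , q) → ≃-sym (re z) (re w) p , ≃-sym (im z) (im w) q
                  ; trans = λ {z} {w} {u} (p , q) (p′ , q′) →
                      ≃-trans (re z) (re w) (re u) p p′ , ≃-trans (im z) (im w) (im u) q q′
                  }
                ; ∙-cong = λ {z} {w} {u} {v} (p , q) (p′ , q′) →
                    +ℝ-cong (re z) (re w) (re u) (re v) p p′ , +ℝ-cong (im z) (im w) (im u) (im v) q q′
                }
              ; assoc = λ z w u → pointwiseℂ ((z + w) + u) (z + (w + u))
                  (λ n → ℚ.+-assoc (seq (re z) n) (seq (re w) n) (seq (re u) n))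
                  (λ n → ℚ.+-assoc (seq (im z) n) (seq (im w) n) (seq (im u) n))
              }
            ; identity =
                (λ z → pointwiseℂ (0# + z) z (λ n → ℚ.+-identityˡ (seq (re z) n)) (λ n → ℚ.+-identityˡ (seq (im z) n)))
              , (λ z → pointwiseℂ (z + 0#) z (λ n → ℚ.+-identityʳ (seq (re z) n)) (λ n → ℚ.+-identityʳ (seq (im z) n)))
            }
          ; inverse =
              (λ z → pointwiseℂ (- z + z) 0# (λ n → ℚ.+-inverseˡ (seq (re z) n)) (λ n → ℚ.+-inverseˡ (seq (im z) n)))
            , (λ z → pointwiseℂ (z + - z) 0# (λ n → ℚ.+-inverseʳ (seq (re z) n)) (λ n → ℚ.+-inverseʳ (seq (im z) n)))
          ; ⁻¹-cong = λ {z} {w} (p , q) → -ℝ-cong (re z) (re w) p , -ℝ-cong (im z) (im w) q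
          }
        ; comm = λ z w → pointwiseℂ (z + w) (w + z)
            (λ n → ℚ.+-comm (seq (re z) n) (seq (re w) n)) (λ n → ℚ.+-comm (seq (im z) n) (seq (im w) n))
        }
      ; *-cong = λ {z} {w} {u} {v} → *-cong z w u v
      ; *-assoc = λ z w u → pointwiseℂ ((z * w) * u) (z * (w * u))
          (λ n → assoc-re (seq (re z) n) (seq (im z) n) (seq (re w) n) (seq (im w) n) (seq (re u) n) (seq (im u) n))
          (λ n → assoc-im (seq (re z) n) (seq (im z) n) (seq (re w) n) (seq (im w) n) (seq (re u) n) (seq (im u) n))
      ; *-identity =
          (λ z → pointwiseℂ (1# * z) z
            (λ n → identityˡ-re (seq (re z) n) (seq (im z) n)) (λ n → identityˡ-im (seq (re z) n) (seq (im z) n)))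
        , (λ z → pointwiseℂ (z * 1#) z
            (λ n → identityʳ-re (seq (re z) n) (seq (im z) n)) (λ n → identityʳ-im (seq (re z) n) (seq (im z) n)))
      ; distrib =
          (λ z w u → pointwiseℂ (z * (w + u)) ((z * w) + (z * u))
            (λ n → distribˡ-re (seq (re z) n) (seq (im z) n) (seq (re w) n) (seq (im w) n) (seq (re u) n) (seq (im u) n))
            (λ n → distribˡ-im (seq (re z) n) (seq (im z) n) (seq (re w) n) (seq (im w) n) (seq (re u) n) (seq (im u) n)))
        , (λ z w u → pointwiseℂ ((w + u) * z) ((w * z) + (u * z))
            (λ n → distribʳ-re (seq (re z) n) (seq (im z) n) (seq (re w) n) (seq (im w) n) (seq (re u) n) (seq (im u) n))
            (λ n → distribʳ-im (seq (re z) n) (seq (im z) n) (seq (re w) n) (seq (im w) n) (seq (re u) n) (seq (im u) n)))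
      }
    ; *-comm = λ z w → pointwiseℂ (z * w) (w * z)
        (λ n → comm-re (seq (re z) n) (seq (im z) n) (seq (re w) n) (seq (im w) n))
        (λ n → comm-im (seq (re z) n) (seq (im z) n) (seq (re w) n) (seq (im w) n))
    }
  }
  where
  open ℂ-identities
  open RawRing ℂ-rawRing using (_≈_; _+_; _*_; -_; 0#; 1#)

  *-cong : ∀ z w u v → z ≈ w → u ≈ v → z * u ≈ w * v
  *-cong z w u v (p , q) (p′ , q′) =
      +ℝ-cong (re z *ℝ re u) (re w *ℝ re v) (-ℝ (im z *ℝ im u)) (-ℝ (im w *ℝ im v))
        (*ℝ-cong (re z) (re w) (re u) (re v) p p′)
        (-ℝ-cong (im z *ℝ im u) (im w *ℝ im v) (*ℝ-cong (im z) (im w) (im u) (im v) q q′))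
    , +ℝ-cong (re z *ℝ im u) (re w *ℝ im v) (im z *ℝ re u) (im w *ℝ re v)
        (*ℝ-cong (re z) (re w) (im u) (im v) p q′)
        (*ℝ-cong (im z) (im w) (re u) (re v) q p′)

-- Zero, apartness and cancellation

Null : ℝ → Set
Null x = ∀ ε → 0ℚ ℚ.< ε → ∃[ N ] (∀ n → N ℕ.≤ n → ℚ.∣ seq x n ∣ ℚ.< ε)

-- The positive form of being nonzero. The explicit `δ` is what permits cancellation; the negation
-- of `x ≃ 0ℝ` would not provide it.
Apart : ℝ → Set
Apart x = ∃[ δ ] 0ℚ ℚ.< δ × ∃[ N ] (∀ n → N ℕ.≤ n → δ ℚ.≤ ℚ.∣ seq x n ∣)

≃0⇒null : ∀ x → x ≃ 0ℝ → Null x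
≃0⇒null x x≃0 ε 0<ε =
  let N , small = x≃0 ε 0<ε
  in N , λ n n≥N → subst (λ d → ℚ.∣ d ∣ ℚ.< ε) (ℚ.+-identityʳ (seq x n)) (small n n≥N)

null⇒≃0 : ∀ x → Null x → x ≃ 0ℝ
null⇒≃0 x null ε 0<ε =
  let N , small = null ε 0<ε
  in N , λ n n≥N → subst (λ d → ℚ.∣ d ∣ ℚ.< ε) (sym (ℚ.+-identityʳ (seq x n))) (small n n≥N)

*-pos : ∀ {p q} → 0ℚ ℚ.< p → 0ℚ ℚ.< q → 0ℚ ℚ.< p ℚ.* q
*-pos {p} {q} 0<p 0<q = ℚ.positive⁻¹ (p ℚ.* q)
  {{ℚ.pos*pos⇒pos p {{ℚ.positive 0<p}} q {{ℚ.positive 0<q}}}}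

half-< : ∀ {ε} → 0ℚ ℚ.< ε → ½ ℚ.* ε ℚ.< ε
half-< {ε} 0<ε = subst (½ ℚ.* ε ℚ.<_) (half+half ε)
  (subst (ℚ._< ½ ℚ.* ε ℚ.+ ½ ℚ.* ε) (ℚ.+-identityʳ (½ ℚ.* ε)) (ℚ.+-monoʳ-< (½ ℚ.* ε) (half-pos {ε} 0<ε)))

split-∣∣ : ∀ p q → ℚ.∣ p ∣ ℚ.≤ ℚ.∣ p ℚ.- q ∣ ℚ.+ ℚ.∣ q ∣
split-∣∣ p q = subst (λ d → ℚ.∣ d ∣ ℚ.≤ ℚ.∣ p ℚ.- q ∣ ℚ.+ ℚ.∣ q ∣) (rejoin p q) (ℚ.∣p+q∣≤∣p∣+∣q∣ (p ℚ.- q) q)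
  where
  open +-*-Solver
  rejoin : ∀ p q → (p ℚ.- q) ℚ.+ q ≡ p
  rejoin = solve 2 (λ p q → (p :- q) :+ q := p) refl

-- From a stage `N` on, terms differ by less than ε/4, and the rational `∣ seq x N ∣` is compared
-- with ε/2, which is decidable. If it is smaller, the tail stays below ε; if not, the tail stays at
-- least ε/4 away from 0, against the hypothesis.
¬apart⇒≃0 : ∀ x → ¬ Apart x → x ≃ 0ℝ
¬apart⇒≃0 x ¬apart = null⇒≃0 x λ ε 0<ε →
  let η   = ½ ℚ.* ε
      0<η = half-pos {ε} 0<ε
      ζ   = ½ ℚ.* η
      N , close = cauchy x ζ (half-pos {η} 0<η)
  in fromDec ε η ζ refl refl 0<η N close (ℚ.∣ seq x N ∣ ℚ.<? η)
  where
  fromDec : ∀ ε η ζ → η ≡ ½ ℚ.* ε → ζ ≡ ½ ℚ.* η → 0ℚ ℚ.< η → ∀ N →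
    (∀ m n → N ℕ.≤ m → N ℕ.≤ n → ℚ.∣ seq x m ℚ.- seq x n ∣ ℚ.< ζ) →
    Dec (ℚ.∣ seq x N ∣ ℚ.< η) → ∃[ N ] (∀ n → N ℕ.≤ n → ℚ.∣ seq x n ∣ ℚ.< ε)
  fromDec ε η ζ refl refl 0<η N close (yes small) = N , λ n n≥N →
    ℚ.≤-<-trans (split-∣∣ (seq x n) (seq x N))
      (subst (ℚ.∣ seq x n ℚ.- seq x N ∣ ℚ.+ ℚ.∣ seq x N ∣ ℚ.<_) (half+half ε)
        (ℚ.+-mono-< (ℚ.<-trans (close n N n≥N ℕ.≤-refl) (half-< {η} 0<η)) small))
  fromDec ε η ζ refl refl 0<η N close (no large) = ⊥-elim (¬apart
    (ζ , half-pos {η} 0<η , N , λ n n≥N → ℚ.≮⇒≥ λ smaller → ℚ.<-irrefl refl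
      (ℚ.≤-<-trans (ℚ.≮⇒≥ large) (ℚ.≤-<-trans (split-∣∣ (seq x N) (seq x n))
        (subst (ℚ.∣ seq x N ℚ.- seq x n ∣ ℚ.+ ℚ.∣ seq x n ∣ ℚ.<_) (half+half η)
          (ℚ.+-mono-< (close N n ℕ.≤-refl n≥N) smaller))))))

apart-cancel : ∀ x y → Apart x → x *ℝ y ≃ 0ℝ → y ≃ 0ℝ
apart-cancel x y (δ , 0<δ , M , δ≤) xy≃0 = null⇒≃0 y λ ε 0<ε →
  let N , small = ≃0⇒null (x *ℝ y) xy≃0 (δ ℚ.* ε) (*-pos 0<δ 0<ε)
  in M ℕ.⊔ N , λ n n≥ → ℚ.*-cancelˡ-<-nonNeg δ {{ℚ.nonNegative (ℚ.<⇒≤ 0<δ)}}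
    (ℚ.≤-<-trans
      (ℚ.*-monoʳ-≤-nonNeg ℚ.∣ seq y n ∣ {{ℚ.∣-∣-nonNeg (seq y n)}} (δ≤ n (ℕ.m⊔n≤o⇒m≤o M N n≥)))
      (subst (ℚ._< δ ℚ.* ε) (ℚ.∣p*q∣≡∣p∣*∣q∣ (seq x n) (seq y n)) (small n (ℕ.m⊔n≤o⇒n≤o M N n≥))))

apart⇒≄0 : ∀ x → Apart x → ¬ (x ≃ 0ℝ)
apart⇒≄0 x (δ , 0<δ , M , δ≤) x≃0 =
  let N , small = ≃0⇒null x x≃0 δ 0<δ
  in ℚ.<-irrefl refl (ℚ.≤-<-trans (δ≤ (M ℕ.⊔ N) (ℕ.m≤m⊔n M N)) (small (M ℕ.⊔ N) (ℕ.m≤n⊔m M N)))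

*ℝ-null : ∀ a x → x ≃ 0ℝ → a *ℝ x ≃ 0ℝ
*ℝ-null a x x≃0 = ≃-trans (a *ℝ x) (a *ℝ 0ℝ) 0ℝ
  (*ℝ-cong a a x 0ℝ (pointwise a a λ _ → refl) x≃0)
  (pointwise (a *ℝ 0ℝ) 0ℝ λ n → ℚ.*-zeroʳ (seq a n))

+ℝ-null : ∀ x y → x ≃ 0ℝ → y ≃ 0ℝ → x +ℝ y ≃ 0ℝ
+ℝ-null x y x≃0 y≃0 = ≃-trans (x +ℝ y) (0ℝ +ℝ 0ℝ) 0ℝ (+ℝ-cong x 0ℝ y 0ℝ x≃0 y≃0)
  (pointwise (0ℝ +ℝ 0ℝ) 0ℝ λ _ → refl)

square-∣∣ : ∀ p → ℚ.∣ p ∣ ℚ.* ℚ.∣ p ∣ ≡ p ℚ.* p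
square-∣∣ p with ℚ.∣p∣≡p∨∣p∣≡-p p
... | inj₁ eq = cong₂ ℚ._*_ eq eq
... | inj₂ eq = trans (cong₂ ℚ._*_ eq eq) (neg² p)
  where
  open +-*-Solver
  neg² : ∀ p → (ℚ.- p) ℚ.* (ℚ.- p) ≡ p ℚ.* p
  neg² = solve 1 (λ p → (:- p) :* (:- p) := p :* p) refl

square-nonNeg : ∀ p → 0ℚ ℚ.≤ p ℚ.* p
square-nonNeg p = subst (0ℚ ℚ.≤_) (square-∣∣ p) (ℚ.nonNegative⁻¹ _
  {{ℚ.nonNeg*nonNeg⇒nonNeg ℚ.∣ p ∣ {{ℚ.∣-∣-nonNeg p}} ℚ.∣ p ∣ {{ℚ.∣-∣-nonNeg p}}}})

square-mono : ∀ {ε} p → 0ℚ ℚ.< ε → ε ℚ.≤ ℚ.∣ p ∣ → ε ℚ.* ε ℚ.≤ p ℚ.* p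
square-mono {ε} p 0<ε ε≤∣p∣ = subst (ε ℚ.* ε ℚ.≤_) (square-∣∣ p) (ℚ.≤-trans
  (ℚ.*-monoʳ-≤-nonNeg ε {{ℚ.nonNegative (ℚ.<⇒≤ 0<ε)}} ε≤∣p∣)
  (ℚ.*-monoˡ-≤-nonNeg ℚ.∣ p ∣ {{ℚ.∣-∣-nonNeg p}} ε≤∣p∣))

≤∣∣ : ∀ p → p ℚ.≤ ℚ.∣ p ∣
≤∣∣ p with ℚ.≤-total 0ℚ p
... | inj₁ 0≤p = ℚ.≤-reflexive (sym (ℚ.0≤p⇒∣p∣≡p 0≤p))
... | inj₂ p≤0 = ℚ.≤-trans p≤0 (ℚ.0≤∣p∣ p)

sumOfSquares-null : ∀ x y → (x *ℝ x) +ℝ (y *ℝ y) ≃ 0ℝ → x ≃ 0ℝ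
sumOfSquares-null x y eq = null⇒≃0 x λ ε 0<ε →
  let N , small = ≃0⇒null ((x *ℝ x) +ℝ (y *ℝ y)) eq (ε ℚ.* ε) (*-pos 0<ε 0<ε)
  in N , λ n n≥N → ℚ.≰⇒> λ ε≤ → ℚ.<-irrefl refl (ℚ.≤-<-trans
    (ℚ.≤-trans (square-mono (seq x n) 0<ε ε≤)
      (ℚ.≤-trans (subst (ℚ._≤ (seq x n ℚ.* seq x n) ℚ.+ (seq y n ℚ.* seq y n))
          (ℚ.+-identityʳ (seq x n ℚ.* seq x n))
          (ℚ.+-monoʳ-≤ (seq x n ℚ.* seq x n) (square-nonNeg (seq y n))))
        (≤∣∣ ((seq x n ℚ.* seq x n) ℚ.+ (seq y n ℚ.* seq y n)))))
    (small n n≥N))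

open CommutativeRing ℂ-commutativeRing
  using (_≈_; _+_; _*_; -_; _-_; 0#; 1#; *-assoc; *-congˡ; *-congʳ; *-identityˡ)
  renaming (trans to ≈-trans; sym to ≈-sym; zeroʳ to *-zeroʳ)
open PolynomialFunctions ℂ-commutativeRing using (Regular)

norm² : ℂ → ℝ
norm² z = (re z *ℝ re z) +ℝ (im z *ℝ im z)

-- Multiplying `z * w` by the conjugate of `z` gives the real number `norm² z` times `w`, which is
-- cancelled in each component separately.
apart⇒regular : ∀ z → Apart (norm² z) → Regular z
apart⇒regular z apart w (re≃0 , im≃0) =
    apart-cancel (norm² z) e apart (≃-trans (norm² z *ℝ e) (a *ℝ re (z * w) +ℝ b *ℝ im (z * w)) 0ℝ
      (pointwise (norm² z *ℝ e) (a *ℝ re (z * w) +ℝ b *ℝ im (z * w))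
        λ n → expand-re (seq a n) (seq b n) (seq e n) (seq f n))
      (+ℝ-null (a *ℝ re (z * w)) (b *ℝ im (z * w))
        (*ℝ-null a (re (z * w)) re≃0) (*ℝ-null b (im (z * w)) im≃0)))
  , apart-cancel (norm² z) f apart (≃-trans (norm² z *ℝ f) (a *ℝ im (z * w) +ℝ (-ℝ b) *ℝ re (z * w)) 0ℝ
      (pointwise (norm² z *ℝ f) (a *ℝ im (z * w) +ℝ (-ℝ b) *ℝ re (z * w))
        λ n → expand-im (seq a n) (seq b n) (seq e n) (seq f n))
      (+ℝ-null (a *ℝ im (z * w)) ((-ℝ b) *ℝ re (z * w))
        (*ℝ-null a (im (z * w)) im≃0) (*ℝ-null (-ℝ b) (re (z * w)) re≃0)))
  where
  a = re z
  b = im z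
  e = re w
  f = im w
  open +-*-Solver
  expand-re : ∀ a b e f → (a ℚ.* a ℚ.+ b ℚ.* b) ℚ.* e ≡
    a ℚ.* (a ℚ.* e ℚ.- b ℚ.* f) ℚ.+ b ℚ.* (a ℚ.* f ℚ.+ b ℚ.* e)
  expand-re = solve 4 (λ a b e f → (a :* a :+ b :* b) :* e :=
    a :* (a :* e :- b :* f) :+ b :* (a :* f :+ b :* e)) refl
  expand-im : ∀ a b e f → (a ℚ.* a ℚ.+ b ℚ.* b) ℚ.* f ≡
    a ℚ.* (a ℚ.* f ℚ.+ b ℚ.* e) ℚ.+ (ℚ.- b) ℚ.* (a ℚ.* e ℚ.- b ℚ.* f)
  expand-im = solve 4 (λ a b e f → (a :* a :+ b :* b) :* f :=
    a :* (a :* f :+ b :* e) :+ (:- b) :* (a :* e :- b :* f)) refl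

-- The distinction is whether `norm² z` is apart from 0. When it is not, the sum of the two squares
-- is zero, and so are both parts of `z`.
regular-or-zero : ∀ z → ¬ ¬ (z ≈ 0# ⊎ Regular z)
regular-or-zero z k = ¬¬-excluded-middle {A = Apart (norm² z)} λ
  { (yes apart)  → k (inj₂ (apart⇒regular z apart))
  ; (no ¬apart) →
      let norm≃0 = ¬apart⇒≃0 (norm² z) ¬apart
      in k (inj₁ (sumOfSquares-null (re z) (im z) norm≃0 , sumOfSquares-null (im z) (re z)
          (≃-trans ((im z *ℝ im z) +ℝ (re z *ℝ re z)) (norm² z) 0ℝ
            (pointwise ((im z *ℝ im z) +ℝ (re z *ℝ re z)) (norm² z)
              λ n → ℚ.+-comm (seq (im z) n ℚ.* seq (im z) n) (seq (re z) n ℚ.* seq (re z) n))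
            norm≃0)))
  }

1≉0 : ¬ (1# ≈ 0#)
1≉0 (1≃0 , _) =
  let N , small = 1≃0 1ℚ (ℚ.positive⁻¹ 1ℚ)
  in ℚ.<-irrefl refl (small N ℕ.≤-refl)

rational-regular : ∀ z q → q ≢ 0ℚ → (∀ n → seq (re z) n ≡ q) → (∀ n → seq (im z) n ≡ 0ℚ) → Regular z
rational-regular z q q≢0 re≡q im≡0 w zw≈0 = ≈-trans {w} {1# * w} {0#} (≈-sym {1# * w} {w} (*-identityˡ w))
  (≈-trans {1# * w} {(u * z) * w} {0#} (*-congʳ {w} {1#} {u * z} (≈-sym {u * z} {1#} uz≈1))
    (≈-trans {(u * z) * w} {u * (z * w)} {0#} (*-assoc u z w)
      (≈-trans {u * (z * w)} {u * 0#} {0#} (*-congˡ {u} {z * w} {0#} zw≈0) (*-zeroʳ u))))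
  where
  instance
    q-nonZero : ℚ.NonZero q
    q-nonZero = ℚ.≢-nonZero q≢0
  u : ℂ
  u = fromℝ (constant (ℚ.1/ q))
  open +-*-Solver
  real-part : ∀ p r → p ℚ.* r ℚ.- 0ℚ ℚ.* 0ℚ ≡ p ℚ.* r
  real-part = solve 2 (λ p r → p :* r :- con 0ℚ :* con 0ℚ := p :* r) refl
  imaginary-part : ∀ p r → p ℚ.* 0ℚ ℚ.+ 0ℚ ℚ.* r ≡ 0ℚ
  imaginary-part = solve 2 (λ p r → p :* con 0ℚ :+ con 0ℚ :* r := con 0ℚ) refl
  uz≈1 : u * z ≈ 1#
  uz≈1 = pointwiseℂ (u * z) 1#
    (λ n → trans (cong₂ (λ x y → ℚ.1/ q ℚ.* x ℚ.- 0ℚ ℚ.* y) (re≡q n) (im≡0 n))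
      (trans (real-part (ℚ.1/ q) q) (ℚ.*-inverseˡ q)))
    (λ n → trans (cong₂ (λ x y → ℚ.1/ q ℚ.* y ℚ.+ 0ℚ ℚ.* x) (re≡q n) (im≡0 n))
      (imaginary-part (ℚ.1/ q) q))

halve : ∀ z → z + z ≈ 0# → z ≈ 0#
halve z z+z≈0 = rational-regular two (1ℚ ℚ.+ 1ℚ) (λ ()) (λ _ → refl) (λ _ → refl) z
  (≈-trans {two * z} {z + z} {0#} (pointwiseℂ (two * z) (z + z)
    (λ n → double-re (seq (re z) n) (seq (im z) n)) (λ n → double-im (seq (re z) n) (seq (im z) n))) z+z≈0)
  where
  two : ℂ
  two = fromℝ (constant (1ℚ ℚ.+ 1ℚ))
  open +-*-Solver
  double-re : ∀ a b → (1ℚ ℚ.+ 1ℚ) ℚ.* a ℚ.- 0ℚ ℚ.* b ≡ a ℚ.+ a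
  double-re = solve 2 (λ a b → con (1ℚ ℚ.+ 1ℚ) :* a :- con 0ℚ :* b := a :+ a) refl
  double-im : ∀ a b → (1ℚ ℚ.+ 1ℚ) ℚ.* b ℚ.+ 0ℚ ℚ.* a ≡ b ℚ.+ b
  double-im = solve 2 (λ a b → con (1ℚ ℚ.+ 1ℚ) :* b :+ con 0ℚ :* a := b :+ b) refl

natural : ℕ → ℚ
natural zero    = 0ℚ
natural (suc k) = 1ℚ ℚ.+ natural k

natural-< : ∀ {j k} → j ℕ.< k → natural j ℚ.< natural k
natural-< {j} j<k with ℕ.≤⇒≤′ j<k
... | j<′k = go j<′k
  where
  step-< : ∀ k → natural k ℚ.< natural (suc k)
  step-< k = subst (ℚ._< natural (suc k)) (ℚ.+-identityˡ (natural k))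
    (ℚ.+-monoˡ-< (natural k) (ℚ.positive⁻¹ 1ℚ))
  go : ∀ {k} → suc j ℕ.≤′ k → natural j ℚ.< natural k
  go ℕ.≤′-refl             = step-< j
  go (ℕ.≤′-step {n = k} p) = ℚ.<-trans (go p) (step-< k)

-- The shift by one keeps 0 out of the sequence, as `cancel-z` requires every point to be regular.
point : ℕ → ℂ
point k = fromℝ (constant (natural (suc k)))

point-regular : ∀ k → Regular (point k)
point-regular k = rational-regular (point k) (natural (suc k))
  (ℚ.<⇒≢ (natural-< {0} {suc k} (ℕ.s≤s ℕ.z≤n)) ∘ sym) (λ _ → refl) (λ _ → refl)

points-apart : ∀ {j k} → j ℕ.< k → Regular (point k - point j)
points-apart {j} {k} j<k = rational-regular (point k - point j) (natural (suc k) ℚ.- natural (suc j))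
  (λ eq → ℚ.<⇒≢ (natural-< {suc j} {suc k} (ℕ.s≤s j<k)) (sym (difference (natural (suc k)) (natural (suc j)) eq)))
  (λ _ → refl) (λ _ → refl)
  where
  open +-*-Solver
  rejoin : ∀ p q → p ≡ (p ℚ.- q) ℚ.+ q
  rejoin = solve 2 (λ p q → p := (p :- q) :+ q) refl
  difference : ∀ p q → p ℚ.- q ≡ 0ℚ → p ≡ q
  difference p q eq = trans (rejoin p q) (trans (cong (ℚ._+ q) eq) (ℚ.+-identityˡ q))

-- Simple spectra from strict interlacing

<ℝ-trans : ∀ {x y z} → x <ℝ y → y <ℝ z → x <ℝ z
<ℝ-trans {x} {y} {z} (ε , 0<ε , M , x<y) (δ , 0<δ , N , y<z) = ε , 0<ε , M ℕ.⊔ N , λ n n≥ →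
  ℚ.<-trans (x<y n (ℕ.m⊔n≤o⇒m≤o M N n≥)) (ℚ.<-trans
    (subst (ℚ._< seq y n ℚ.+ δ) (ℚ.+-identityʳ (seq y n)) (ℚ.+-monoʳ-< (seq y n) 0<δ))
    (y<z n (ℕ.m⊔n≤o⇒n≤o M N n≥)))

0<⇒apart : ∀ x y → x ≃ 0ℝ → x <ℝ y → Apart y
0<⇒apart x y x≃0 (ε , 0<ε , M , x<y) =
  let η = ½ ℚ.* ε
      N , small = ≃0⇒null x x≃0 η (half-pos {ε} 0<ε)
  in η , half-pos {ε} 0<ε , M ℕ.⊔ N , λ n n≥ → ℚ.<⇒≤
    (ℚ.<-≤-trans (bound (seq x n) (seq y n) (x<y n (ℕ.m⊔n≤o⇒m≤o M N n≥)) (small n (ℕ.m⊔n≤o⇒n≤o M N n≥)))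
      (≤∣∣ (seq y n)))
  where
  open +-*-Solver
  rearrange : ∀ p η → (p ℚ.+ (η ℚ.+ η)) ℚ.+ (ℚ.- p) ≡ η ℚ.+ η
  rearrange = solve 2 (λ p η → (p :+ (η :+ η)) :+ (:- p) := η :+ η) refl
  bound : ∀ p q → p ℚ.+ ε ℚ.< q → ℚ.∣ p ∣ ℚ.< ½ ℚ.* ε → ½ ℚ.* ε ℚ.< q
  bound p q p+ε<q ∣p∣<η = ℚ.≰⇒> λ q≤η → ℚ.<-irrefl refl
    (ℚ.<-trans
      (subst (ℚ._< ½ ℚ.* ε ℚ.+ (ℚ.- p)) (rearrange p (½ ℚ.* ε))
        (ℚ.+-monoˡ-< (ℚ.- p) (subst (λ e → p ℚ.+ e ℚ.< ½ ℚ.* ε) (sym (half+half ε)) (ℚ.<-≤-trans p+ε<q q≤η))))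
      (ℚ.+-monoʳ-< (½ ℚ.* ε) (ℚ.≤-<-trans (≤∣∣ (ℚ.- p)) (subst (ℚ._< ½ ℚ.* ε) (sym (ℚ.∣-p∣≡∣p∣ p)) ∣p∣<η))))

-- The form of distinctness that `noDoubleRoot` consumes: a zero root is to be separated from the
-- later ones. On the imaginary axis `norm²` is the square of the coefficient, so a bound `δ` for
-- the latter gives `δ ℚ.* δ`.
0<⇒regular : ∀ {s t} → s <ⁱ t → fromiℝ s ≈ 0# → Regular (fromiℝ t)
0<⇒regular {i· s} {i· t} s<t (_ , s≃0) = apart⇒regular (fromiℝ (i· t)) (square-apart (0<⇒apart s t s≃0 s<t))
  where
  square-apart : Apart t → Apart (norm² (fromiℝ (i· t)))
  square-apart (δ , 0<δ , N , δ≤) = δ ℚ.* δ , *-pos 0<δ 0<δ , N , λ n n≥N → ℚ.≤-trans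
    (square-mono (seq t n) 0<δ (δ≤ n n≥N))
    (ℚ.≤-trans (ℚ.≤-reflexive (sym (ℚ.+-identityˡ (seq t n ℚ.* seq t n)))) (≤∣∣ (0ℚ ℚ.+ seq t n ℚ.* seq t n)))

interlaced-above : ∀ {k m t a} {ts : Vec iℝ k} {cs : Vec iℝ m} →
  t <ⁱ a → ts StrictlyInterlaces (a ∷ cs) → All (t <ⁱ_) ts
interlaced-above t<a base = []
interlaced-above {t = t} t<a (step {a = a} {b} {c} a<b b<c rest) = t<b ∷ interlaced-above {t = t} t<c rest
  where
  t<b : t <ⁱ b
  t<b = <ℝ-trans {coefficient t} {coefficient a} {coefficient b} t<a a<b
  t<c : t <ⁱ c
  t<c = <ℝ-trans {coefficient t} {coefficient b} {coefficient c} t<b b<c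

-- Consecutive entries of `ts` are separated by an entry of `cs`. All pairs are compared, not only
-- consecutive ones, because `noDoubleRoot` sets a zero root against every later root.
interlacing⇒increasing : ∀ {k m} {ts : Vec iℝ k} {cs : Vec iℝ m} → ts StrictlyInterlaces cs → AllPairs _<ⁱ_ ts
interlacing⇒increasing base             = []
interlacing⇒increasing (step {b = b} _ b<c rest) = interlaced-above {t = b} b<c rest ∷ interlacing⇒increasing rest

-- Components and parity

¬¬-∀Subset : ∀ {n} {P : Subset n → Set} → (∀ S → ¬ ¬ P S) → ¬ ¬ (∀ S → P S)
¬¬-∀Subset {zero}  f k = f [] λ p → k λ { [] → p }
¬¬-∀Subset {suc n} f k =
  ¬¬-∀Subset (λ S → f (inside ∷ S)) λ p → ¬¬-∀Subset (λ S → f (outside ∷ S)) λ q →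
    k λ { (inside ∷ S) → p S ; (outside ∷ S) → q S }

¬¬-→ : ∀ {P Q : Set} → (P → ¬ ¬ Q) → ¬ ¬ (P → Q)
¬¬-→ f k = k λ p → ⊥-elim (f p λ q → k λ _ → q)

2∤⇒odd : ∀ n → 2 ∤ n → ∃[ m ] n ≡ suc (m ℕ.* 2)
2∤⇒odd zero          2∤0 = ⊥-elim (2∤0 (2 ∣0))
2∤⇒odd (suc zero)    _   = 0 , refl
2∤⇒odd (suc (suc n)) 2∤n with m , eq ← 2∤⇒odd n (2∤n ∘ ∣m∣n⇒∣m+n ∣-refl) = suc m , cong (ℕ._+_ 2) eq

2∤suc⇒2∣ : ∀ {n} → 2 ∤ suc n → 2 ∣ n
2∤suc⇒2∣ {n} 2∤1+n = decidable-stable (2 ∣? n) λ 2∤n →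
  let m , eq = 2∤⇒odd n 2∤n in 2∤1+n (divides (suc m) (cong suc eq))

2∣suc⇒2∤ : ∀ {n} → 2 ∣ suc n → 2 ∤ n
2∣suc⇒2∤ {n} 2∣1+n 2∣n with () ← ∣1⇒≡1 (∣m+n∣m⇒∣n (subst (2 ∣_) (ℕ.+-comm 1 n) 2∣1+n) 2∣n)

module Components {n} (G : Graph n) where

  Path : Subset n → Fin n → Fin n → Set
  Path S = Star (InducedAdj G S)

  path-reverse : ∀ {S x y} → Path S x y → Path S y x
  path-reverse = Star.reverse λ (i∈ , j∈ , adj) → j∈ , i∈ , symmetric G adj

  path-end : ∀ {S x y} → x ∈ S → Path S x y → y ∈ S
  path-end x∈S Star.ε                      = x∈S
  path-end x∈S ((_ , j∈S , _) ◅ path) = path-end j∈S path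

  component-path : ∀ {S C x y} → IsComponent G S C → x ∈ C → y ∈ C → Path S x y
  component-path (_ , _ , reach) x∈C = Equivalence.to (reach _ _ x∈C)

  component-closed : ∀ {S C x y} → IsComponent G S C → x ∈ C → Path S x y → y ∈ C
  component-closed (_ , _ , reach) x∈C = Equivalence.from (reach _ _ x∈C)

  component-unique : ∀ {S C C′ x} → IsComponent G S C → IsComponent G S C′ →
    x ∈ C → x ∈ C′ → C ≡ C′
  component-unique isC isC′ x∈C x∈C′ = Subset.⊆-antisym
    (λ y∈C → component-closed isC′ x∈C′ (component-path isC x∈C y∈C))
    (λ y∈C′ → component-closed isC x∈C (component-path isC′ x∈C′ y∈C′))

  -- Adjacency is an arbitrary relation, so reachability from `x` is not decidable. It is decided
  -- under ¬ ¬ for all vertices together, and the answers are tabulated into a subset.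
  componentOf : ∀ {S x} → x ∈ S → ¬ ¬ (∃[ C ] x ∈ C × IsComponent G S C)
  componentOf {S} {x} x∈S k = ¬¬-∀Fin (λ y → ¬¬-excluded-middle {A = Path S x y}) λ path? →
    let C = Vec.tabulate (does ∘ path?)
        to : ∀ {y} → Path S x y → y ∈ C
        to {y} p = Vec.lookup⇒[]= y C (trans (Vec.lookup∘tabulate _ y) (dec-true (path? y) p))
        from : ∀ {y} → y ∈ C → Path S x y
        from {y} y∈C = fromDoes (path? y) (trans (sym (Vec.lookup∘tabulate (does ∘ path?) y)) (Vec.[]=⇒lookup y∈C))
    in k (C , to Star.ε , (x , to Star.ε) , (λ y∈C → path-end x∈S (from y∈C)) ,
         λ a b a∈C → mk⇔ (λ b∈C → path-reverse (from a∈C) ◅◅ from b∈C)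
                         (λ path → to (from a∈C ◅◅ path)))
    where
    fromDoes : ∀ {P : Set} (P? : Dec P) → does P? ≡ inside → P
    fromDoes (yes p) _ = p

  -- A path in `S` that starts outside `C` never enters `C`: an edge leading into `C`, read
  -- backwards, would put its starting point into `C`.
  component-─ : ∀ {S C D} → IsComponent G S C → IsComponent G (S Subset.─ C) D → IsComponent G S D
  component-─ {S} {C} {D} isC (nonempty , D⊆ , reach) =
      nonempty , S─C⊆S ∘ D⊆
    , λ a b a∈D → mk⇔
        (λ b∈D → Star.map (λ (i∈ , j∈ , adj) → S─C⊆S i∈ , S─C⊆S j∈ , adj)
          (Equivalence.to (reach a b a∈D) b∈D))
        (λ path → Equivalence.from (reach a b a∈D) (avoid (D⊆ a∈D) path))
    where
    S─C⊆S : S Subset.─ C Subset.⊆ S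
    S─C⊆S = Subset.p─q⊆p S C
    avoid : ∀ {a b} → a ∈ S Subset.─ C → Path S a b → Path (S Subset.─ C) a b
    avoid a∈ Star.ε = Star.ε
    avoid a∈ (_◅_ {j = j} (a∈S , j∈S , adj) path) = (a∈ , j∈ , adj) ◅ avoid j∈ path
      where
      j∈ : j ∈ S Subset.─ C
      j∈ = Subset.x∈p∧x∉q⇒x∈p─q j∈S λ j∈C → x∈p─q⇒x∉q {p = S} a∈
        (component-closed isC j∈C ((j∈S , a∈S , symmetric G adj) ◅ Star.ε))

  size-─ : ∀ {S C} → IsComponent G S C → ∣ S Subset.─ C ∣ ℕ.+ ∣ C ∣ ≡ ∣ S ∣
  size-─ {S} {C} (_ , C⊆S , _) = ∣p─q∣+∣q∣≡∣p∣ S C C⊆S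

  -- An even component is removed and the search goes on in the rest, whose size is still odd. The
  -- bound `k` drives the recursion, as the rest is smaller than `S` only in cardinality.
  oddComponent : ∀ {S} → 2 ∤ ∣ S ∣ → ¬ ¬ ∃ (IsOddComponent G S)
  oddComponent {S} 2∤∣S∣ = bySize ∣ S ∣ S ℕ.≤-refl 2∤∣S∣
    where
    bySize : ∀ k S → ∣ S ∣ ℕ.≤ k → 2 ∤ ∣ S ∣ → ¬ ¬ ∃ (IsOddComponent G S)
    bySize k S ∣S∣≤k 2∤∣S∣ none
      with x , x∈S ← ∣p∣≡suc⇒Nonempty S (proj₂ (2∤⇒odd ∣ S ∣ 2∤∣S∣)) =
      componentOf x∈S λ (C , x∈C , isC) → fromComponent k ∣S∣≤k C x∈C isC (2 ∣? ∣ C ∣)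
      where
      fromComponent : ∀ k → ∣ S ∣ ℕ.≤ k → ∀ C {x} → x ∈ C → IsComponent G S C → Dec (2 ∣ ∣ C ∣) → ⊥
      fromComponent k       _     C x∈C isC (no 2∤∣C∣)  = none (C , isC , 2∤∣C∣)
      fromComponent zero    ∣S∣≤0 C x∈C isC (yes 2∣∣C∣) =
        2∤∣S∣ (subst (2 ∣_) (sym (ℕ.n≤0⇒n≡0 ∣S∣≤0)) (2 ∣0))
      fromComponent (suc k) ∣S∣≤k C {x} x∈C isC (yes 2∣∣C∣) =
        bySize k (S Subset.─ C)
          (ℕ.≤-pred (ℕ.≤-trans (Subset.p∩q≢∅⇒∣p─q∣<∣p∣ S C
            (x , Subset.x∈p∩q⁺ (proj₁ (proj₂ isC) x∈C , x∈C))) ∣S∣≤k))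
          (λ 2∣ → 2∤∣S∣ (subst (2 ∣_) (size-─ isC) (∣m∣n⇒∣m+n 2∣ 2∣∣C∣)))
          λ (D , isD , 2∤∣D∣) → none (D , component-─ isC isD , 2∤∣D∣)

  -- Removing an odd component from a set of even size leaves a set of odd size, which has an odd
  -- component of its own. This one is nonempty and disjoint from `C`, hence different.
  secondOddComponent : ∀ {S C} → 2 ∣ ∣ S ∣ → IsOddComponent G S C →
    ¬ ¬ (∃[ D ] C ≢ D × IsOddComponent G S D)
  secondOddComponent {S} {C} 2∣∣S∣ (isC , 2∤∣C∣) k =
    oddComponent {S Subset.─ C}
      (λ 2∣ → 2∤∣C∣ (∣m+n∣m⇒∣n (subst (2 ∣_) (sym (size-─ isC)) 2∣∣S∣) 2∣))
      λ (D , isD@((x , x∈D) , D⊆ , _) , 2∤∣D∣) →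
        k (D , (λ { refl → x∈p─q⇒x∉q {p = S} (D⊆ x∈D) x∈D }) , component-─ isC isD , 2∤∣D∣)

-- From odd components to odd blocks, and the NEB property

complexify-skew : ∀ {n} {A : Matrix ℝ n} → IsSkewSymmetric A →
  ∀ i j → fromℝ (A j i) ≈ - fromℝ (A i j)
complexify-skew skew i j = skew i j , pointwise 0ℝ (-ℝ 0ℝ) λ _ → refl

-- An entry apart from 0 would be an edge, and failure of apartness gives equality with 0. The graph
-- records only entries above the diagonal; for the others skew-symmetry supplies the mirrored
-- entry.
nonadjacent⇒≃0 : ∀ {n} {A : Matrix ℝ n} → IsSkewSymmetric A → ∀ {i j} → i ≢ j →
  ¬ Adj (graph A) j i → A i j ≃ 0ℝ
nonadjacent⇒≃0 {A = A} skew {i} {j} i≢j ¬adj = ¬apart⇒≃0 (A i j) λ apart →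
  ¬adj (edge (apart⇒≄0 (A i j) apart))
  where
  edge : ¬ (A i j ≃ 0ℝ) → Adj (graph A) j i
  edge Aij≄0 with Fin.<-cmp i j
  ... | tri< i<j _ _ = inj₂ (i<j , Aij≄0)
  ... | tri≈ _ i≡j _ = ⊥-elim (i≢j i≡j)
  ... | tri> _ _ j<i = inj₁ (j<i , λ Aji≃0 → Aij≄0 (≃-trans (A i j) (-ℝ A j i) 0ℝ (skew j i)
    (≃-trans (-ℝ A j i) (-ℝ 0ℝ) 0ℝ (-ℝ-cong (A j i) 0ℝ Aji≃0) (pointwise (-ℝ 0ℝ) 0ℝ λ _ → refl))))

open SkewSymmetric.Kernels ℂ-commutativeRing 1≉0 halve regular-or-zero
  using (oddBlocks-intersect; IsOddBlock; Enumeration; elementsEnumeration; δ)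

private
  module Raw = RawRing ℂ-rawRing

complexify : ∀ {n} → Matrix ℝ n → Matrix ℂ n
complexify A i j = fromℝ (A i j)

simpleSpectrum⇒oddBlocks-intersect : ∀ {m n} {A : Matrix ℝ n} {A′ : Matrix ℝ m} {e S C C′} →
  IsSkewSymmetric A → Enumeration e S → (∀ i j → A′ i j ≡ A (e i) (e j)) →
  IsOddBlock (complexify A) S C → IsOddBlock (complexify A) S C′ →
  {ts : Vec iℝ m} → AllPairs _<ⁱ_ ts → HasSpectrum A′ ts →
  ¬ (∀ {i} → i ∈ C → i ∉ C′)
simpleSpectrum⇒oddBlocks-intersect {A = A} {A′} {e}
  skew enumeration A′≡ block block′ {ts} increasing spectrum disjoint =
  oddBlocks-intersect point point-regular points-apart fromiℝ {B = complexify A} {B′ = complexify A′}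
    enumeration
    (λ i j → pointwiseℂ (fromℝ (A′ i j)) (fromℝ (A (e i) (e j)))
      (λ n → cong (λ x → seq x n) (A′≡ i j)) (λ _ → refl))
    (complexify-skew {A = A} skew) block block′ disjoint
    (AllPairs.map (λ {s} {t} → 0<⇒regular {s} {t}) increasing)
    {N = N} N≈ {φ = φ} φ≈ spectrum
  where
  N : ℂ → Matrix ℂ _
  N z i j = z Raw.* (if does (i Fin.≟ j) then Raw.1# else Raw.0#) Raw.+ Raw.- fromℝ (A′ i j)
  φ : ℂ → iℝ → ℂ → ℂ
  φ z t p = (z Raw.+ Raw.- fromiℝ t) Raw.* p
  N≈ : ∀ z i j → N z i j ≈ z * δ i j + - complexify A′ i j
  N≈ z i j = pointwiseℂ (N z i j) (z * δ i j + - complexify A′ i j) (λ _ → refl) (λ _ → refl)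
  φ≈ : ∀ z t p → φ z t p ≈ (z - fromiℝ t) * p
  φ≈ z t p = pointwiseℂ (φ z t p) ((z - fromiℝ t) * p) (λ _ → refl) (λ _ → refl)

module _ {n} {T : Graph n} {A : Matrix ℝ n} (skew : IsSkewSymmetric A)
         (sameEdges : ∀ i j → Adj (graph A) i j ⇔ Adj T i j) where
  open Components T

  oddComponent⇒oddBlock : ∀ {S C} → IsOddComponent T S C →
    IsOddBlock (complexify A) S C
  oddComponent⇒oddBlock {S} {C} (isC , 2∤∣C∣) = record
    { half     = proj₁ (2∤⇒odd ∣ C ∣ 2∤∣C∣)
    ; C⊆S      = C⊆S
    ; odd      = proj₂ (2∤⇒odd ∣ C ∣ 2∤∣C∣)
    ; isolated = λ {i} {j} i∈S i∉C j∈C →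
        nonadjacent⇒≃0 {A = A} skew (λ { refl → i∉C j∈C }) (λ adj → i∉C (component-closed isC j∈C
          ((C⊆S j∈C , i∈S , Equivalence.to (sameEdges j i) adj) ◅ Star.ε)))
        , pointwise 0ℝ 0ℝ λ _ → refl
    }
    where
    C⊆S = proj₁ (proj₂ isC)

  -- Distinct components are disjoint, which the linear algebra excludes. As equality of subsets is
  -- decidable, this refutation becomes an equality free of double negation.
  oddComponents-equal : ∀ {S} {ts : Vec iℝ ∣ S ∣} →
    HasSpectrum (principalSubmatrix A S) ts → AllPairs _<ⁱ_ ts →
    ∀ {C C′} → IsOddComponent T S C → IsOddComponent T S C′ → C ≡ C′
  oddComponents-equal {S} {ts} spectrum increasing {C} {C′} odd odd′ =
    decidable-stable (Vec.≡-dec Bool._≟_ C C′) λ C≢C′ →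
      simpleSpectrum⇒oddBlocks-intersect {A = A} {principalSubmatrix A S} {Vec.lookup (elements S)}
        skew (elementsEnumeration S) (λ _ _ → refl)
        (oddComponent⇒oddBlock odd) (oddComponent⇒oddBlock odd′) {ts} increasing spectrum
        (λ i∈C i∈C′ → C≢C′ (component-unique (proj₁ odd) (proj₁ odd′) i∈C i∈C′))

  branch-transfer : ∀ {S w v C} → IsBranch T S w v C → IsBranch (graph A) S w v C
  branch-transfer {S} {w} (adj , v∈C , nonempty , C⊆ , reach) =
      Equivalence.from (sameEdges _ _) adj , v∈C , nonempty , C⊆
    , λ x y x∈C → mk⇔
        (Star.map (λ (i∈ , j∈ , a) → i∈ , j∈ , Equivalence.from (sameEdges _ _) a) ∘ Equivalence.to (reach x y x∈C))
        (Equivalence.from (reach x y x∈C) ∘ Star.map (λ (i∈ , j∈ , a) → i∈ , j∈ , Equivalence.to (sameEdges _ _) a))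

  -- The recursion follows the derivation of the Duarte property. Membership `w ∈ S` is carried
  -- along because the parity argument compares `∣ S ∣` with the size after deleting `w`. The odd
  -- case is itself a negation and is proved outright; the even case asserts existence and is
  -- obtained under ¬ ¬.
  duarte⇒¬¬NEB : ∀ {S w} → w ∈ S → DuarteOn A S w → ¬ ¬ NEBOn T S w
  duarte⇒¬¬NEB w∈S (single ∣S∣≡1) k = k (single ∣S∣≡1)
  duarte⇒¬¬NEB {S} {w} w∈S (branch 2≤∣S∣ λs μs _ spectrum interlaces branches) k =
    ¬¬-→ evenCase λ even →
    ¬¬-∀Fin {P = λ v → ∀ C → IsBranch T S w v C → NEBOn T C v} (λ v → ¬¬-∀Subset λ C → ¬¬-→ λ b →
      duarte⇒¬¬NEB (proj₁ (proj₂ b)) (branches v C (branch-transfer b))) λ subbranches →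
    k (branch 2≤∣S∣ even oddCase subbranches)
    where
    size : suc ∣ S Subset.- w ∣ ≡ ∣ S ∣
    size = suc∣p-x∣≡∣p∣ w∈S
    equal : ∀ {C C′} → IsOddComponent T (S Subset.- w) C → IsOddComponent T (S Subset.- w) C′ → C ≡ C′
    equal = oddComponents-equal {S Subset.- w} {μs} spectrum (interlacing⇒increasing interlaces)
    evenCase : 2 ∣ ∣ S ∣ → ¬ ¬ ∃! _≡_ (IsOddComponent T (S Subset.- w))
    evenCase 2∣ none = oddComponent {S Subset.- w} (2∣suc⇒2∤ (subst (2 ∣_) (sym size) 2∣))
      λ (C , odd) → none (C , odd , equal odd)
    oddCase : 2 ∤ ∣ S ∣ → ¬ ∃ (IsOddComponent T (S Subset.- w))
    oddCase 2∤ (C , odd) = secondOddComponent (2∤suc⇒2∣ (2∤ ∘ subst (2 ∣_) size)) odd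
      λ (D , C≢D , odd′) → C≢D (equal odd odd′)

theorem2p5 : ∀ (n : ℕ) → n ≥ 3 → (T : Graph n) → IsTree T → (v : Fin n) →
    ¬ IsNEB T v →
    ∀ (A : Matrix ℝ n) → A ∈S⁻ T → ¬ HasDuarteProperty A v
theorem2p5 n _ T _ v ¬NEB A (skew , sameEdges) duarte =
  duarte⇒¬¬NEB skew sameEdges Subset.∈⊤ duarte ¬NEB
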